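{- Let $\mathbf k\in(\mathbb N\cup\{\infty\})^\ell$. The ideal $\mathcal I\mathcal O^{\mathbf k}\subseteq\mathrm{NSym}^{(\ell)}$ equals the two-sided ideal generated by $\{\Phi_{\mathbf n}:\mathbf 0<\mathbf n\le\mathbf k,\ |\mathbf n|\text{ even}\}$. Dually, the $\mathbf k$-odd subalgebra $\mathcal O^{\mathbf k}\subseteq\mathrm{QSym}^{(\ell)}$ is the $\mathbb Q$-span of those $P_{(\mathbf i_1,\dots,\mathbf i_m)}$ such that for every $r$, $\mathbf i_r\le\mathbf k$ implies $|\mathbf i_r|$ is odd.
   Context: Fix $\ell\ge1$. $\mathbb N^\ell$: column vectors, weight $|\mathbf n|=\sum n_i$, coordinatewise order extended to $(\mathbb N\cup\{\infty\})^\ell$. Vector composition: sequence $\mathbf I=(\mathbf i_1,\dots,\mathbf i_m)$ of nonzero elements of $\mathbb N^\ell$. $\mathrm{QSym}^{(\ell)}$: $\mathbb Q$-span of $M_{\mathbf I}=\sum_{j_1<\dots<j_m}\mathbf x_{j_1}^{\mathbf i_1}\cdots\mathbf x_{j_m}^{\mathbf i_m}$ ($M_{()}=1$) in commuting variables $x_j^{(i)}$, $\mathbf x_j^{\mathbf n}=\prod_i(x_j^{(i)})^{n_i}$; $\mathbb N^\ell$-graded connected Hopf algebra with product of power series and deconcatenation coproduct $\Delta M_{\mathbf I}=\sum_{\mathbf I=\mathbf J\mathbf K}M_{\mathbf J}\otimes M_{\mathbf K}$. $\zeta_{\mathcal Q}$: character with $\zeta_{\mathcal Q}(M_{\mathbf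 I})=1$ if $\mathbf I$ has length $\le1$, else $0$; $\bar\zeta_{\mathcal Q}(h)=(-1)^{|\mathbf n|}\zeta_{\mathcal Q}(h)$ for $h$ of degree $\mathbf n$; $\zeta_{\mathcal Q}^{ -1}$ its convolution inverse. $\mathrm{NSym}^{(\ell)}$ is the graded dual of $\mathrm{QSym}^{(\ell)}$, with basis $S^{\mathbf I}$ dual to $M_{\mathbf I}$; setting $S_{\mathbf n}=S^{(\mathbf n)}$, one has $S^{\mathbf I}=S_{\mathbf i_1}\cdots S_{\mathbf i_m}$, and the degree-$\mathbf n$ part of $\zeta_{\mathcal Q}$ is $S_{\mathbf n}$. $\Phi_{\mathbf n}$ defined by $\sum_{\mathbf n\ne\mathbf 0}\frac{\Phi_{\mathbf n}}{|\mathbf n|}t^{\mathbf n}=\log(1+\sum_{\mathbf n\ne\mathbf 0}S_{\mathbf n}t^{\mathbf n})$ with commuting $t_i$, $t^{\mathbf n}=\prod t_i^{n_i}$; $\Phi^{\mathbf I}=\Phi_{\mathbf i_1}\cdots\Phi_{\mathbf i_m}$ is a basis of $\mathrm{NSym}^{(\ell)}$ and $(P_{\mathbf I})$ is the dual basis of $\mathrm{QSym}^{(\ell)}$. $\mathcal I\mathcal O^{\mathbf k}$ is the ideal of $\mathrm{NSym}^{(\ell)}$ generated by $(\bar\zeta_{\mathcal Q})_{\mathbf n}-(\zeta_{\mathcal Q}^{ -1})_{\mathbf n}$ for $\mathbf n\in\mathbb N^\ell$, $\mathbf n\le\mathbf k$ (subscript = restriction to degree $\mathbf n$). $\mathcal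 O^{\mathbf k}$ is the largest graded subcoalgebra $C$ of $\mathrm{QSym}^{(\ell)}$ such that $\bar\zeta_{\mathcal Q}(h)=\zeta_{\mathcal Q}^{ -1}(h)$ for all $h\in C$ of degree $\le\mathbf k$. -}

module Defs where

open import Data.Nat as ℕ using (ℕ; zero; suc; NonZero)
open import Data.Nat.Divisibility using (_∣_)
open import Data.Integer using (+_)
open import Data.Rational as ℚ using (ℚ; 0ℚ; 1ℚ; _/_)
open import Data.Vec as Vec using (Vec; []; _∷_)
import Data.Vec.Properties as VecP
open import Data.List as List using (List; []; _∷_; _++_; length)
import Data.List.Properties as ListP
open import Data.List.Relation.Unary.All using (All)
open import Data.Product using (Σ; Σ-syntax; ∃; ∃-syntax; _×_; _,_; proj₁; proj₂)
open import Data.Unit using (⊤)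
open import Relation.Nullary using (Dec; yes; no; ¬_)
open import Relation.Binary.Definitions using (DecidableEquality)
open import Relation.Binary.PropositionalEquality using (_≡_; refl; cong)

data ℕ∞ : Set where
  fin : ℕ → ℕ∞
  ∞   : ℕ∞

_≤ᵢ_ : ℕ → ℕ∞ → Set
m ≤ᵢ fin n = m ℕ.≤ n
m ≤ᵢ ∞     = ⊤

_≤k_ : ∀ {ℓ} → Vec ℕ ℓ → Vec ℕ∞ ℓ → Set
[]       ≤k []       = ⊤
(m ∷ ms) ≤k (k ∷ ks) = (m ≤ᵢ k) × (ms ≤k ks)

weight : ∀ {ℓ} → Vec ℕ ℓ → ℕ
weight = Vec.sum

Even Odd : ℕ → Set
Even n = 2 ∣ n
Odd n = ¬ (2 ∣ n)

NZ : ℕ → Set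
NZ ℓ = Σ (Vec ℕ ℓ) (λ v → NonZero (weight v))

nonZero-irr : ∀ {n} (p q : NonZero n) → p ≡ q
nonZero-irr {suc n} p q = refl

_≟NZ_ : ∀ {ℓ} → DecidableEquality (NZ ℓ)
(v , p) ≟NZ (w , q) with VecP.≡-dec ℕ._≟_ v w
... | no v≢w = no (λ eq → v≢w (cong proj₁ eq))
... | yes refl with nonZero-irr p q
...   | refl = yes refl

Comp : ℕ → Set
Comp ℓ = List (NZ ℓ)

_≟C_ : ∀ {ℓ} → DecidableEquality (Comp ℓ)
_≟C_ = ListP.≡-dec _≟NZ_

zeroV : ∀ {ℓ} → Vec ℕ ℓ
zeroV = Vec.replicate _ 0

_+V_ : ∀ {ℓ} → Vec ℕ ℓ → Vec ℕ ℓ → Vec ℕ ℓ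
_+V_ = Vec.zipWith ℕ._+_

-- ‖I‖ = i₁ + … + i_m ∈ ℕ^ℓ  (the degree of M_I and of S^I)
‖_‖ : ∀ {ℓ} → Comp ℓ → Vec ℕ ℓ
‖ I ‖ = List.foldr (λ i acc → proj₁ i +V acc) zeroV I

∣_∣C : ∀ {ℓ} → Comp ℓ → ℕ
∣ I ∣C = weight ‖ I ‖

sgn : ℕ → ℚ
sgn zero    = 1ℚ
sgn (suc m) = ℚ.- sgn m

ℚsum : List ℚ → ℚ
ℚsum = List.foldr ℚ._+_ 0ℚ

δ : ∀ {ℓ} → Comp ℓ → Comp ℓ → ℚ
δ I J with I ≟C J
... | yes _ = 1ℚ
... | no _  = 0ℚ

splits : ∀ {A : Set} → List A → List (List A × List A)
splits []       = ([] , []) ∷ []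
splits (x ∷ xs) = ([] , x ∷ xs) ∷ List.map (λ p → (x ∷ proj₁ p , proj₂ p)) (splits xs)

-- Linear functionals on QSym^(ℓ), given by their values on the basis
-- (M_I).  Equivalently (graded dual), elements of the completion of
-- NSym^(ℓ) given by their coefficients on the basis (S^I).

Fun : ℕ → Set
Fun ℓ = Comp ℓ → ℚ

-- convolution  (φ ⋆ ψ)(M_I) = Σ_{I = J K} φ(M_J) ψ(M_K)
-- (dual to deconcatenation; on NSym^(ℓ) this is the product, S^J S^K = S^{JK})
_⋆_ : ∀ {ℓ} → Fun ℓ → Fun ℓ → Fun ℓ
(φ ⋆ ψ) I = ℚsum (List.map (λ p → φ (proj₁ p) ℚ.* ψ (proj₂ p)) (splits I))

_⊕_ : ∀ {ℓ} → Fun ℓ → Fun ℓ → Fun ℓ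
(φ ⊕ ψ) I = φ I ℚ.+ ψ I

_⊖_ : ∀ {ℓ} → Fun ℓ → Fun ℓ → Fun ℓ
(φ ⊖ ψ) I = φ I ℚ.- ψ I

zeroF : ∀ {ℓ} → Fun ℓ
zeroF _ = 0ℚ

εF : ∀ {ℓ} → Fun ℓ
εF []      = 1ℚ
εF (_ ∷ _) = 0ℚ

_≈F_ : ∀ {ℓ} → Fun ℓ → Fun ℓ → Set
φ ≈F ψ = ∀ I → φ I ≡ ψ I

ζQ : ∀ {ℓ} → Fun ℓ
ζQ []          = 1ℚ
ζQ (_ ∷ [])    = 1ℚ
ζQ (_ ∷ _ ∷ _) = 0ℚ

ζ̄Q : ∀ {ℓ} → Fun ℓ
ζ̄Q I = sgn ∣ I ∣C ℚ.* ζQ I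

IsConvInverse : ∀ {ℓ} → Fun ℓ → Fun ℓ → Set
IsConvInverse φ ψ = ((φ ⋆ ψ) ≈F εF) × ((ψ ⋆ φ) ≈F εF)

-- restriction of a functional to degree n, viewed in NSym^(ℓ):
-- φ_n = Σ_{‖I‖ = n} φ(M_I) S^I
part : ∀ {ℓ} → Fun ℓ → Vec ℕ ℓ → Fun ℓ
part φ n I with VecP.≡-dec ℕ._≟_ ‖ I ‖ n
... | yes _ = φ I
... | no _  = 0ℚ

-- NSym^(ℓ): finite formal Q-linear combinations Σ a S^I

NSym : ℕ → Set
NSym ℓ = List (ℚ × Comp ℓ)

coeff : ∀ {ℓ} → List (ℚ × Comp ℓ) → Fun ℓ
coeff xs I = ℚsum (List.map (λ p → proj₁ p ℚ.* δ (proj₂ p) I) xs)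

-- Φ_n, defined by Σ_{n≠0} Φ_n/|n| t^n = log(1 + Σ_{n≠0} S_n t^n);
-- expanding log(1+X) = Σ_{m≥1} (-1)^{m-1} X^m / m, the coefficient of
-- t^n is Σ_{‖I‖ = n} (-1)^{ℓ(I)-1}/ℓ(I) S^I, hence
logCoeff : ℕ → ℚ
logCoeff zero    = 0ℚ
logCoeff (suc m) = sgn m ℚ.* ((+ 1) / suc m)

Φ : ∀ {ℓ} → Vec ℕ ℓ → Fun ℓ
Φ n = part (λ I → (+ weight n / 1) ℚ.* logCoeff (length I)) n

Φ^ : ∀ {ℓ} → Comp ℓ → Fun ℓ
Φ^ I = List.foldr (λ i acc → Φ (proj₁ i) ⋆ acc) εF I

data InIdeal {ℓ} (G : Fun ℓ → Set) : Fun ℓ → Set where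
  gen  : ∀ {g} → G g → InIdeal G g
  zer  : InIdeal G zeroF
  add  : ∀ {x y} → InIdeal G x → InIdeal G y → InIdeal G (x ⊕ y)
  mulL : ∀ {x} (a : NSym ℓ) → InIdeal G x → InIdeal G (coeff a ⋆ x)
  mulR : ∀ {x} (a : NSym ℓ) → InIdeal G x → InIdeal G (x ⋆ coeff a)
  resp : ∀ {x y} → x ≈F y → InIdeal G x → InIdeal G y

-- QSym^(ℓ): finite formal Q-linear combinations Σ a M_I

QSym : ℕ → Set
QSym ℓ = List (ℚ × Comp ℓ)

_≈Q_ : ∀ {ℓ} → QSym ℓ → QSym ℓ → Set
h ≈Q h' = coeff h ≈F coeff h'

_•_ : ∀ {ℓ} → ℚ → QSym ℓ → QSym ℓ
c • h = List.map (λ p → (c ℚ.* proj₁ p , proj₂ p)) h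

⟨_,_⟩ : ∀ {ℓ} → QSym ℓ → Fun ℓ → ℚ
⟨ h , φ ⟩ = ℚsum (List.map (λ p → proj₁ p ℚ.* φ (proj₂ p)) h)

compo : ∀ {ℓ} → Vec ℕ ℓ → QSym ℓ → QSym ℓ
compo n h = List.map (λ p → (part (λ _ → proj₁ p) n (proj₂ p) , proj₂ p)) h

Homogeneous : ∀ {ℓ} → Vec ℕ ℓ → QSym ℓ → Set
Homogeneous n h = h ≈Q compo n h

IsDualToΦ : ∀ {ℓ} → (Comp ℓ → QSym ℓ) → Set
IsDualToΦ P = ∀ I J → ⟨ P I , Φ^ J ⟩ ≡ δ I J

IsSubspace : ∀ {ℓ} → (QSym ℓ → Set) → Set
IsSubspace {ℓ} C =
  (∀ {h h'} → h ≈Q h' → C h → C h') ×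
  C [] ×
  (∀ {h h'} → C h → C h' → C (h ++ h')) ×
  (∀ c {h} → C h → C (c • h))

-- Δ(h) ∈ C ⊗ C, where the coefficient of M_J ⊗ M_K in Δh is the
-- coefficient of M_{JK} in h (deconcatenation coproduct)
ΔIn⊗ : ∀ {ℓ} → (QSym ℓ → Set) → QSym ℓ → Set
ΔIn⊗ {ℓ} C h =
  ∃[ ts ] All (λ t → C (proj₁ t) × C (proj₂ t)) ts ×
    (∀ J K → coeff h (J ++ K) ≡
       ℚsum (List.map (λ t → coeff (proj₁ t) J ℚ.* coeff (proj₂ t) K) ts))

IsGradedSubcoalgebra : ∀ {ℓ} → (QSym ℓ → Set) → Set
IsGradedSubcoalgebra {ℓ} C =
  IsSubspace C ×
  (∀ {h} → C h → ∀ n → C (compo n h)) ×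
  (∀ {h} → C h → ΔIn⊗ C h)

OddCondition : ∀ {ℓ} → Vec ℕ∞ ℓ → Fun ℓ → (QSym ℓ → Set) → Set
OddCondition {ℓ} k ζinv C =
  ∀ (n : Vec ℕ ℓ) h → n ≤k k → Homogeneous n h → C h → ⟨ h , ζ̄Q ⟩ ≡ ⟨ h , ζinv ⟩

IsLargestOdd : ∀ {ℓ} → Vec ℕ∞ ℓ → Fun ℓ → (QSym ℓ → Set) → Set₁
IsLargestOdd {ℓ} k ζinv C =
  (IsGradedSubcoalgebra C × OddCondition k ζinv C) ×
  (∀ (D : QSym ℓ → Set) → IsGradedSubcoalgebra D → OddCondition k ζinv D →
     ∀ h → D h → C h)

GenIO : ∀ {ℓ} → Vec ℕ∞ ℓ → Fun ℓ → Fun ℓ → Set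
GenIO {ℓ} k ζinv g = Σ[ n ∈ Vec ℕ ℓ ] n ≤k k × g ≡ (part ζ̄Q n ⊖ part ζinv n)

GenΦ : ∀ {ℓ} → Vec ℕ∞ ℓ → Fun ℓ → Set
GenΦ {ℓ} k g = Σ[ n ∈ NZ ℓ ] proj₁ n ≤k k × Even (weight (proj₁ n)) × g ≡ Φ (proj₁ n)

OddComp : ∀ {ℓ} → Vec ℕ∞ ℓ → Comp ℓ → Set
OddComp k I = All (λ i → proj₁ i ≤k k → Odd (weight (proj₁ i))) I

SpanOddP : ∀ {ℓ} → Vec ℕ∞ ℓ → (Comp ℓ → QSym ℓ) → QSym ℓ → Set
SpanOddP {ℓ} k P h =
  ∃[ cs ] All (λ p → OddComp k (proj₂ p)) cs ×
    (h ≈Q List.concatMap (λ p → proj₁ p • P (proj₂ p)) cs)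

{-# OPTIONS --safe #-}
-- Functionals on QSym form the algebra of noncommutative power series under
-- convolution.  Put x = ζ̄ - ε and y = ζ⁻¹ - ε.  From
--   x^m - y^m = x (x^(m-1) - y^(m-1)) + (x - y) y^(m-1)
-- the degree-n part of log(1+x) - log(1+y) equals that of x - y modulo the ideal
-- generated by the parts of x - y of smaller weight, so both families generate
-- the same ideals.  But log(1+x) has n-part (-1)^|n| Φ_n/|n| and log(1+y) has
-- n-part -Φ_n/|n|, so the difference is 2 Φ_n/|n| for |n| even and 0 for |n| odd.
-- For the dual statement, the span of the odd P_I is the annihilator of the Φ^J
-- with J not odd, and a subcoalgebra annihilates an ideal as soon as it
-- annihilates its generators.
module Submission where

open import Defs
open import Data.Nat as ℕ using (ℕ; zero; suc; _≤_; _<_; z≤n; s≤s; NonZero)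
import Data.Nat.Properties as ℕP
open import Data.Nat.Divisibility as Div using (divides)
open import Data.Integer as ℤ using () renaming (+_ to pos)
import Data.Integer.Properties as ℤP
open import Data.Rational as ℚ using (ℚ; 0ℚ; 1ℚ; _+_; _*_; -_; _-_; _/_; toℚᵘ)
open import Data.Rational.Properties as ℚP using (+-identityˡ; +-identityʳ; *-identityˡ; *-zeroˡ; *-zeroʳ)
open import Data.Rational.Solver using (module +-*-Solver)
import Data.Rational.Unnormalised as ℚᵘ
import Data.Rational.Unnormalised.Properties as ℚᵘP
open import Data.Vec using (Vec; []; _∷_)
import Data.Vec.Properties as VecP
open import Data.List as List using (List; []; _∷_; _++_; length; concatMap; cartesianProductWith; upTo; deduplicate; filter)
open import Data.List.Membership.Propositional using (_∈_; _∉_; lose)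
open import Data.List.Membership.Propositional.Properties using (∈-map⁻; ∈-concatMap⁺; ∈-cartesianProductWith⁺; ∈-upTo⁺; ∈-deduplicate⁺)
import Data.List.Membership.DecPropositional as DecMembership
open import Data.List.Relation.Unary.Any using (here; there)
open import Data.List.Relation.Unary.All as All using (All; []; _∷_)
import Data.List.Relation.Unary.All.Properties as AllP
open import Data.List.Relation.Unary.AllPairs using (_∷_)
open import Data.List.Relation.Unary.Unique.Propositional using (Unique)
import Data.List.Relation.Unary.Unique.DecPropositional.Properties as DecUnique
open import Data.Product using (∃; _×_; _,_; proj₁; proj₂)
open import Data.Unit using (tt)
open import Function.Bundles using (_⇔_; mk⇔)
open import Relation.Nullary using (Dec; yes; no; ¬_; contradiction)
open import Relation.Nullary.Decidable using (_×-dec_; _→-dec_; ¬?)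
open import Relation.Unary using (Decidable)
open import Relation.Binary.Definitions using (DecidableEquality)
open import Relation.Binary.PropositionalEquality using (_≡_; _≢_; refl; sym; trans; cong; cong₂; subst; module ≡-Reasoning)

open +-*-Solver using (solve; _:+_; _:*_; _:-_; :-_; _:=_)

-- That log(1+y) is -log ζ is checked on coefficients, not through an identity for formal
-- logarithms. Since ζ⁻¹ has the value (-1)^length on every composition, the m-th power of y at `I`
-- counts, up to that sign, the ways to cut `I` into m nonempty blocks, and the logarithm becomes an
-- alternating sum of binomial coefficients. The characters are infinite series, while multipliers
-- in an ideal are finite combinations. Hence logarithms are truncated at an exponent no smaller
-- than the lengths involved, and ideal membership is tested on one homogeneous part at a time.
-- Downward closure of the condition n ≤ k makes the parts of smaller degree available. On the dual
-- side the odd span must itself be shown to be a subcoalgebra. The Φ^I multiply by concatenation,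
-- so the P_I deconcatenate; reading this on the basis M requires every S^I to be a combination of
-- the Φ^J, which follows by induction on weight.

private variable
  ℓ : ℕ
  A B P Q R : Set

-- Finite sums

∑ : List A → (A → ℚ) → ℚ
∑ xs f = ℚsum (List.map f xs)

∑-cong-∈ : ∀ (xs : List A) {f g : A → ℚ} → (∀ {x} → x ∈ xs → f x ≡ g x) → ∑ xs f ≡ ∑ xs g
∑-cong-∈ []       e = refl
∑-cong-∈ (x ∷ xs) e = cong₂ _+_ (e (here refl)) (∑-cong-∈ xs (λ m → e (there m)))

∑-cong : ∀ (xs : List A) {f g : A → ℚ} → (∀ x → f x ≡ g x) → ∑ xs f ≡ ∑ xs g
∑-cong xs e = ∑-cong-∈ xs (λ {x} _ → e x)

∑-0 : ∀ (xs : List A) → ∑ xs (λ _ → 0ℚ) ≡ 0ℚ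
∑-0 []       = refl
∑-0 (x ∷ xs) = trans (+-identityˡ _) (∑-0 xs)

∑-zero : ∀ (xs : List A) {f : A → ℚ} → (∀ {x} → x ∈ xs → f x ≡ 0ℚ) → ∑ xs f ≡ 0ℚ
∑-zero xs e = trans (∑-cong-∈ xs e) (∑-0 xs)

∑-++ : ∀ (xs ys : List A) (f : A → ℚ) → ∑ (xs ++ ys) f ≡ ∑ xs f + ∑ ys f
∑-++ []       ys f = sym (+-identityˡ _)
∑-++ (x ∷ xs) ys f = trans (cong (f x +_) (∑-++ xs ys f)) (sym (ℚP.+-assoc (f x) _ _))

∑-+ : ∀ (xs : List A) (f g : A → ℚ) → ∑ xs (λ x → f x + g x) ≡ ∑ xs f + ∑ xs g
∑-+ []       f g = refl
∑-+ (x ∷ xs) f g = trans (cong (f x + g x +_) (∑-+ xs f g))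
  (solve 4 (λ a b c d → (a :+ b) :+ (c :+ d) := (a :+ c) :+ (b :+ d)) refl (f x) (g x) _ _)

∑-*ˡ : ∀ (xs : List A) c (f : A → ℚ) → ∑ xs (λ x → c * f x) ≡ c * ∑ xs f
∑-*ˡ []       c f = sym (*-zeroʳ c)
∑-*ˡ (x ∷ xs) c f = trans (cong (c * f x +_) (∑-*ˡ xs c f)) (sym (ℚP.*-distribˡ-+ c _ _))

∑-*ʳ : ∀ (xs : List A) c (f : A → ℚ) → ∑ xs (λ x → f x * c) ≡ ∑ xs f * c
∑-*ʳ xs c f = trans (∑-cong xs (λ x → ℚP.*-comm (f x) c)) (trans (∑-*ˡ xs c f) (ℚP.*-comm c _))

∑-neg : ∀ (xs : List A) (f : A → ℚ) → ∑ xs (λ x → - f x) ≡ - ∑ xs f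
∑-neg []       f = refl
∑-neg (x ∷ xs) f = trans (cong (- f x +_) (∑-neg xs f)) (sym (ℚP.neg-distrib-+ (f x) _))

∑-map : ∀ (xs : List A) (g : A → B) (f : B → ℚ) → ∑ (List.map g xs) f ≡ ∑ xs (λ x → f (g x))
∑-map []       g f = refl
∑-map (x ∷ xs) g f = cong (f (g x) +_) (∑-map xs g f)

∑-concatMap : ∀ (xs : List A) (g : A → List B) (f : B → ℚ) →
              ∑ (concatMap g xs) f ≡ ∑ xs (λ x → ∑ (g x) f)
∑-concatMap []       g f = refl
∑-concatMap (x ∷ xs) g f = trans (∑-++ (g x) (concatMap g xs) f) (cong (∑ (g x) f +_) (∑-concatMap xs g f))

∑-swap : ∀ (xs : List A) (ys : List B) (f : A → B → ℚ) →
         ∑ xs (λ x → ∑ ys (f x)) ≡ ∑ ys (λ y → ∑ xs (λ x → f x y))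
∑-swap []       ys f = sym (∑-0 ys)
∑-swap (x ∷ xs) ys f = trans (cong (∑ ys (f x) +_) (∑-swap xs ys f)) (sym (∑-+ ys (f x) _))

∑-product : ∀ (xs : List A) (ys : List B) (f : A → ℚ) (g : B → ℚ) →
            ∑ xs (λ x → ∑ ys (λ y → f x * g y)) ≡ ∑ xs f * ∑ ys g
∑-product xs ys f g = trans (∑-cong xs (λ x → ∑-*ˡ ys (f x) g)) (∑-*ʳ xs (∑ ys g) f)

∑-filter : ∀ {P : A → Set} (P? : Decidable P) xs (f : A → ℚ) → (∀ x → ¬ P x → f x ≡ 0ℚ) → ∑ (filter P? xs) f ≡ ∑ xs f
∑-filter P? []       f z = refl
∑-filter P? (x ∷ xs) f z with P? x
... | yes _ = cong (f x +_) (∑-filter P? xs f z)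
... | no ¬p = trans (∑-filter P? xs f z) (sym (trans (cong (_+ ∑ xs f) (z x ¬p)) (+-identityˡ _)))

-- Indicators, and sums that select one term

ind : Dec P → ℚ
ind (yes _) = 1ℚ
ind (no _)  = 0ℚ

ind-yes : (d : Dec P) → P → ind d ≡ 1ℚ
ind-yes (yes _) p = refl
ind-yes (no ¬p) p = contradiction p ¬p

ind-no : (d : Dec P) → ¬ P → ind d ≡ 0ℚ
ind-no (yes p) ¬p = contradiction p ¬p
ind-no (no _)  ¬p = refl

ind-cong : (d : Dec P) (e : Dec Q) → (P → Q) → (Q → P) → ind d ≡ ind e
ind-cong (yes p) e f g = sym (ind-yes e (f p))
ind-cong (no ¬p) e f g = sym (ind-no e (λ q → ¬p (g q)))

ind-× : (d : Dec P) (e : Dec Q) (f : Dec R) → (P → Q × R) → (Q → R → P) → ind d ≡ ind e * ind f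
ind-× d (yes q) f to from = trans (ind-cong d f (λ p → proj₂ (to p)) (from q)) (sym (*-identityˡ (ind f)))
ind-× d (no ¬q) f to from = trans (ind-no d (λ p → ¬q (proj₁ (to p)))) (sym (*-zeroˡ (ind f)))

module _ (_≟_ : DecidableEquality A) where

  ∑-ind-∉ : ∀ c xs (f : A → ℚ) → c ∉ xs → ∑ xs (λ x → ind (x ≟ c) * f x) ≡ 0ℚ
  ∑-ind-∉ c xs f c∉ = ∑-zero xs λ {x} x∈ →
    trans (cong (_* f x) (ind-no (x ≟ c) (λ { refl → c∉ x∈ }))) (*-zeroˡ (f x))

  ∑-ind-∈ : ∀ c xs (f : A → ℚ) → Unique xs → c ∈ xs → ∑ xs (λ x → ind (x ≟ c) * f x) ≡ f c
  ∑-ind-∈ c (c ∷ xs) f (c∉ ∷ _) (here refl) = trans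
    (cong₂ _+_ (trans (cong (_* f c) (ind-yes (c ≟ c) refl)) (*-identityˡ (f c)))
               (∑-ind-∉ c xs f (λ m → All.lookup c∉ m refl)))
    (+-identityʳ (f c))
  ∑-ind-∈ c (x ∷ xs) f (x∉ ∷ u) (there m) = trans
    (cong₂ _+_ (trans (cong (_* f x) (ind-no (x ≟ c) (All.lookup x∉ m))) (*-zeroˡ (f x)))
               (∑-ind-∈ c xs f u m))
    (+-identityˡ (f c))

-- Lets a finite range stand for all of `A`: it must contain `c` unless `f` vanishes there.
-- Uniqueness prevents the term from being counted twice.
∑-ind : ∀ (_≟_ : DecidableEquality A) c xs (f : A → ℚ) → Unique xs → (c ∉ xs → f c ≡ 0ℚ) →
        ∑ xs (λ x → ind (x ≟ c) * f x) ≡ f c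
∑-ind _≟_ c xs f u z with DecMembership._∈?_ _≟_ c xs
... | yes c∈ = ∑-ind-∈ _≟_ c xs f u c∈
... | no c∉  = trans (∑-ind-∉ _≟_ c xs f c∉) (sym (z c∉))

-- The convolution algebra

infixl 7 _·_
_·_ : ℚ → Fun ℓ → Fun ℓ
(c · φ) I = c * φ I

∑F : List A → (A → Fun ℓ) → Fun ℓ
∑F xs f I = ∑ xs (λ x → f x I)

-- Either the prefix of the cut is empty or it begins with `i`. Passing to `λ J → φ (i ∷ J)` acts as
-- a left derivative, and inductions on compositions run along it.
⋆-∷ : ∀ (φ ψ : Fun ℓ) i I → (φ ⋆ ψ) (i ∷ I) ≡ φ [] * ψ (i ∷ I) + ((λ J → φ (i ∷ J)) ⋆ ψ) I
⋆-∷ φ ψ i I = cong (φ [] * ψ (i ∷ I) +_) (∑-map (splits I) _ _)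

⋆-[] : ∀ (φ ψ : Fun ℓ) → (φ ⋆ ψ) [] ≡ φ [] * ψ []
⋆-[] φ ψ = +-identityʳ _

⋆-cong : ∀ {φ φ′ ψ ψ′ : Fun ℓ} → φ ≈F φ′ → ψ ≈F ψ′ → (φ ⋆ ψ) ≈F (φ′ ⋆ ψ′)
⋆-cong e e′ I = ∑-cong (splits I) (λ p → cong₂ _*_ (e (proj₁ p)) (e′ (proj₂ p)))

⋆-congˡ : ∀ {φ φ′ : Fun ℓ} ψ → φ ≈F φ′ → (φ ⋆ ψ) ≈F (φ′ ⋆ ψ)
⋆-congˡ ψ e = ⋆-cong e (λ _ → refl)

⋆-congʳ : ∀ (φ : Fun ℓ) {ψ ψ′} → ψ ≈F ψ′ → (φ ⋆ ψ) ≈F (φ ⋆ ψ′)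
⋆-congʳ φ e = ⋆-cong {φ = φ} (λ _ → refl) e

⋆-∑ˡ : ∀ (xs : List A) (f : A → Fun ℓ) (ψ : Fun ℓ) → (∑F xs f ⋆ ψ) ≈F ∑F xs (λ x → f x ⋆ ψ)
⋆-∑ˡ xs f ψ I = trans (∑-cong (splits I) (λ p → sym (∑-*ʳ xs (ψ (proj₂ p)) _))) (∑-swap (splits I) xs _)

⋆-∑ʳ : ∀ (xs : List A) (φ : Fun ℓ) (f : A → Fun ℓ) → (φ ⋆ ∑F xs f) ≈F ∑F xs (λ x → φ ⋆ f x)
⋆-∑ʳ xs φ f I = trans (∑-cong (splits I) (λ p → sym (∑-*ˡ xs (φ (proj₁ p)) _))) (∑-swap (splits I) xs _)

⋆-·ˡ : ∀ c (φ ψ : Fun ℓ) → ((c · φ) ⋆ ψ) ≈F (c · (φ ⋆ ψ))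
⋆-·ˡ c φ ψ I = trans (∑-cong (splits I) (λ p → ℚP.*-assoc c _ _)) (∑-*ˡ (splits I) c _)

⋆-·ʳ : ∀ c (φ ψ : Fun ℓ) → (φ ⋆ (c · ψ)) ≈F (c · (φ ⋆ ψ))
⋆-·ʳ c φ ψ I = trans
  (∑-cong (splits I) (λ p → solve 3 (λ a b d → a :* (b :* d) := b :* (a :* d)) refl (φ (proj₁ p)) c (ψ (proj₂ p))))
  (∑-*ˡ (splits I) c _)

⋆-⊕ˡ : ∀ (φ φ′ ψ : Fun ℓ) → ((φ ⊕ φ′) ⋆ ψ) ≈F ((φ ⋆ ψ) ⊕ (φ′ ⋆ ψ))
⋆-⊕ˡ φ φ′ ψ I = trans (∑-cong (splits I) (λ p → ℚP.*-distribʳ-+ (ψ (proj₂ p)) (φ (proj₁ p)) (φ′ (proj₁ p)))) (∑-+ (splits I) _ _)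

⋆-⊕ʳ : ∀ (φ ψ ψ′ : Fun ℓ) → (φ ⋆ (ψ ⊕ ψ′)) ≈F ((φ ⋆ ψ) ⊕ (φ ⋆ ψ′))
⋆-⊕ʳ φ ψ ψ′ I = trans (∑-cong (splits I) (λ p → ℚP.*-distribˡ-+ (φ (proj₁ p)) (ψ (proj₂ p)) (ψ′ (proj₂ p)))) (∑-+ (splits I) _ _)

⋆-⊖ˡ : ∀ (φ φ′ ψ : Fun ℓ) → ((φ ⊖ φ′) ⋆ ψ) ≈F ((φ ⋆ ψ) ⊖ (φ′ ⋆ ψ))
⋆-⊖ˡ φ φ′ ψ I = trans
  (∑-cong (splits I) (λ p → solve 3 (λ a b c → (a :- b) :* c := a :* c :+ (:- (b :* c))) refl (φ (proj₁ p)) _ (ψ (proj₂ p))))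
  (trans (∑-+ (splits I) _ _) (cong ((φ ⋆ ψ) I +_) (∑-neg (splits I) _)))

⋆-⊖ʳ : ∀ (φ ψ ψ′ : Fun ℓ) → (φ ⋆ (ψ ⊖ ψ′)) ≈F ((φ ⋆ ψ) ⊖ (φ ⋆ ψ′))
⋆-⊖ʳ φ ψ ψ′ I = trans
  (∑-cong (splits I) (λ p → solve 3 (λ a b c → a :* (b :- c) := a :* b :+ (:- (a :* c))) refl (φ (proj₁ p)) (ψ (proj₂ p)) _))
  (trans (∑-+ (splits I) _ _) (cong ((φ ⋆ ψ) I +_) (∑-neg (splits I) _)))

⋆-zeroˡ : ∀ (φ : Fun ℓ) → (zeroF ⋆ φ) ≈F zeroF
⋆-zeroˡ φ I = ∑-zero (splits I) (λ {p} _ → *-zeroˡ (φ (proj₂ p)))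

⋆-zeroʳ : ∀ (φ : Fun ℓ) → (φ ⋆ zeroF) ≈F zeroF
⋆-zeroʳ φ I = ∑-zero (splits I) (λ {p} _ → *-zeroʳ (φ (proj₁ p)))

⋆-identityˡ : ∀ (φ : Fun ℓ) → (εF ⋆ φ) ≈F φ
⋆-identityˡ φ []      = trans (⋆-[] εF φ) (*-identityˡ _)
⋆-identityˡ φ (i ∷ I) = trans (⋆-∷ εF φ i I)
  (trans (cong₂ _+_ (*-identityˡ (φ (i ∷ I))) (⋆-zeroˡ φ I)) (+-identityʳ _))

⋆-identityʳ : ∀ (φ : Fun ℓ) → (φ ⋆ εF) ≈F φ
⋆-identityʳ φ []      = trans (⋆-[] φ εF) (ℚP.*-identityʳ _)
⋆-identityʳ φ (i ∷ I) = trans (⋆-∷ φ εF i I)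
  (trans (cong₂ _+_ (*-zeroʳ (φ [])) (⋆-identityʳ (λ J → φ (i ∷ J)) I)) (+-identityˡ _))

-- Induction on the composition with `φ` varying: the left derivative of `φ ⋆ ψ` is
-- `(φ [] · ψᵢ) ⊕ (φᵢ ⋆ ψ)`, so the induction hypothesis is used at `φᵢ`.
⋆-assoc : ∀ (φ ψ χ : Fun ℓ) → ((φ ⋆ ψ) ⋆ χ) ≈F (φ ⋆ (ψ ⋆ χ))
⋆-assoc φ ψ χ [] = begin
  ((φ ⋆ ψ) ⋆ χ) []         ≡⟨ ⋆-[] (φ ⋆ ψ) χ ⟩
  (φ ⋆ ψ) [] * χ []        ≡⟨ cong (_* χ []) (⋆-[] φ ψ) ⟩
  φ [] * ψ [] * χ []       ≡⟨ ℚP.*-assoc (φ []) _ _ ⟩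
  φ [] * (ψ [] * χ [])     ≡⟨ cong (φ [] *_) (sym (⋆-[] ψ χ)) ⟩
  φ [] * (ψ ⋆ χ) []        ≡⟨ sym (⋆-[] φ (ψ ⋆ χ)) ⟩
  (φ ⋆ (ψ ⋆ χ)) []         ∎
  where open ≡-Reasoning
⋆-assoc {ℓ} φ ψ χ (i ∷ I) = begin
  ((φ ⋆ ψ) ⋆ χ) (i ∷ I)
    ≡⟨ ⋆-∷ (φ ⋆ ψ) χ i I ⟩
  (φ ⋆ ψ) [] * χ (i ∷ I) + ((λ J → (φ ⋆ ψ) (i ∷ J)) ⋆ χ) I
    ≡⟨ cong₂ _+_ (cong (_* χ (i ∷ I)) (⋆-[] φ ψ)) (⋆-congˡ χ (⋆-∷ φ ψ i) I) ⟩
  φ [] * ψ [] * χ (i ∷ I) + (((φ [] · ψᵢ) ⊕ (φᵢ ⋆ ψ)) ⋆ χ) I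
    ≡⟨ cong (φ [] * ψ [] * χ (i ∷ I) +_) (trans (⋆-⊕ˡ (φ [] · ψᵢ) (φᵢ ⋆ ψ) χ I)
         (cong₂ _+_ (⋆-·ˡ (φ []) ψᵢ χ I) (⋆-assoc φᵢ ψ χ I))) ⟩
  φ [] * ψ [] * χ (i ∷ I) + (φ [] * (ψᵢ ⋆ χ) I + (φᵢ ⋆ (ψ ⋆ χ)) I)
    ≡⟨ solve 5 (λ a b c d e → a :* b :* c :+ (a :* d :+ e) := a :* (b :* c :+ d) :+ e) refl (φ []) (ψ []) (χ (i ∷ I)) _ _ ⟩
  φ [] * (ψ [] * χ (i ∷ I) + (ψᵢ ⋆ χ) I) + (φᵢ ⋆ (ψ ⋆ χ)) I
    ≡⟨ cong (λ z → φ [] * z + (φᵢ ⋆ (ψ ⋆ χ)) I) (sym (⋆-∷ ψ χ i I)) ⟩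
  φ [] * (ψ ⋆ χ) (i ∷ I) + (φᵢ ⋆ (ψ ⋆ χ)) I
    ≡⟨ sym (⋆-∷ φ (ψ ⋆ χ) i I) ⟩
  (φ ⋆ (ψ ⋆ χ)) (i ∷ I) ∎
  where
  open ≡-Reasoning
  φᵢ ψᵢ : Fun ℓ
  φᵢ J = φ (i ∷ J)
  ψᵢ J = ψ (i ∷ J)

δ-ind : ∀ (I J : Comp ℓ) → δ I J ≡ ind (I ≟C J)
δ-ind I J with I ≟C J
... | yes _ = refl
... | no _  = refl

δ-sym : ∀ (I J : Comp ℓ) → δ I J ≡ δ J I
δ-sym I J = trans (δ-ind I J) (trans (ind-cong (I ≟C J) (J ≟C I) sym sym) (sym (δ-ind J I)))

δ-ε : δ {ℓ} [] ≈F εF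
δ-ε []      = refl
δ-ε (_ ∷ _) = refl

δ-∷ : ∀ j J i (I : Comp ℓ) → δ (j ∷ J) (i ∷ I) ≡ ind (j ≟NZ i) * δ J I
δ-∷ j J i I = trans (δ-ind (j ∷ J) (i ∷ I)) (trans
  (ind-× ((j ∷ J) ≟C (i ∷ I)) (j ≟NZ i) (J ≟C I) (λ { refl → refl , refl }) (λ { refl refl → refl }))
  (cong (ind (j ≟NZ i) *_) (sym (δ-ind J I))))

-- As a functional, `δ J` is the basis element S^J, so this is the multiplication rule of NSym.
δ-⋆ : ∀ (J K : Comp ℓ) → (δ J ⋆ δ K) ≈F δ (J ++ K)
δ-⋆ []      K I       = trans (⋆-congˡ (δ K) δ-ε I) (⋆-identityˡ (δ K) I)
δ-⋆ (j ∷ J) K []      = trans (⋆-[] (δ (j ∷ J)) (δ K)) (*-zeroˡ (δ K []))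
δ-⋆ (j ∷ J) K (i ∷ I) = begin
  (δ (j ∷ J) ⋆ δ K) (i ∷ I)
    ≡⟨ ⋆-∷ (δ (j ∷ J)) (δ K) i I ⟩
  0ℚ * δ K (i ∷ I) + ((λ I′ → δ (j ∷ J) (i ∷ I′)) ⋆ δ K) I
    ≡⟨ cong₂ _+_ (*-zeroˡ (δ K (i ∷ I))) (⋆-congˡ (δ K) (δ-∷ j J i) I) ⟩
  0ℚ + ((ind (j ≟NZ i) · δ J) ⋆ δ K) I
    ≡⟨ trans (+-identityˡ _) (⋆-·ˡ (ind (j ≟NZ i)) (δ J) (δ K) I) ⟩
  ind (j ≟NZ i) * (δ J ⋆ δ K) I
    ≡⟨ cong (ind (j ≟NZ i) *_) (δ-⋆ J K I) ⟩
  ind (j ≟NZ i) * δ (J ++ K) I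
    ≡⟨ sym (δ-∷ j (J ++ K) i I) ⟩
  δ (j ∷ J ++ K) (i ∷ I) ∎
  where open ≡-Reasoning

-- Degrees and weights

_≟V_ : DecidableEquality (Vec ℕ ℓ)
_≟V_ = VecP.≡-dec ℕ._≟_

+V-identityʳ : ∀ (v : Vec ℕ ℓ) → v +V zeroV ≡ v
+V-identityʳ = VecP.zipWith-identityʳ ℕP.+-identityʳ

weight-+V : ∀ (u v : Vec ℕ ℓ) → weight (u +V v) ≡ weight u ℕ.+ weight v
weight-+V []      []      = refl
weight-+V (a ∷ u) (b ∷ v) = begin
  a ℕ.+ b ℕ.+ weight (u +V v)               ≡⟨ cong (a ℕ.+ b ℕ.+_) (weight-+V u v) ⟩
  a ℕ.+ b ℕ.+ (weight u ℕ.+ weight v)       ≡⟨ ℕP.+-assoc a b _ ⟩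
  a ℕ.+ (b ℕ.+ (weight u ℕ.+ weight v))     ≡⟨ cong (a ℕ.+_) (sym (ℕP.+-assoc b _ _)) ⟩
  a ℕ.+ (b ℕ.+ weight u ℕ.+ weight v)       ≡⟨ cong (λ z → a ℕ.+ (z ℕ.+ weight v)) (ℕP.+-comm b _) ⟩
  a ℕ.+ (weight u ℕ.+ b ℕ.+ weight v)       ≡⟨ cong (a ℕ.+_) (ℕP.+-assoc (weight u) b _) ⟩
  a ℕ.+ (weight u ℕ.+ (b ℕ.+ weight v))     ≡⟨ sym (ℕP.+-assoc a (weight u) _) ⟩
  a ℕ.+ weight u ℕ.+ (b ℕ.+ weight v)       ∎
  where open ≡-Reasoning

weight-zeroV : ∀ ℓ → weight (zeroV {ℓ}) ≡ 0
weight-zeroV zero    = refl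
weight-zeroV (suc ℓ) = weight-zeroV ℓ

‖‖-++ : ∀ (I J : Comp ℓ) → ‖ I ++ J ‖ ≡ ‖ I ‖ +V ‖ J ‖
‖‖-++ []      J = sym (VecP.zipWith-identityˡ ℕP.+-identityˡ _)
‖‖-++ (i ∷ I) J = trans (cong (proj₁ i +V_) (‖‖-++ I J)) (sym (VecP.zipWith-assoc ℕP.+-assoc (proj₁ i) _ _))

∣∣C-∷ : ∀ i (I : Comp ℓ) → ∣ i ∷ I ∣C ≡ weight (proj₁ i) ℕ.+ ∣ I ∣C
∣∣C-∷ i I = weight-+V (proj₁ i) ‖ I ‖

∣∣C-++ : ∀ (I J : Comp ℓ) → ∣ I ++ J ∣C ≡ ∣ I ∣C ℕ.+ ∣ J ∣C
∣∣C-++ I J = trans (cong weight (‖‖-++ I J)) (weight-+V ‖ I ‖ ‖ J ‖)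

weight-positive : ∀ (i : NZ ℓ) → 1 ≤ weight (proj₁ i)
weight-positive (v , nz) = ℕP.n≢0⇒n>0 (ℕ.≢-nonZero⁻¹ (weight v) ⦃ nz ⦄)

length≤∣∣C : ∀ (I : Comp ℓ) → length I ≤ ∣ I ∣C
length≤∣∣C []      = z≤n
length≤∣∣C (i ∷ I) = ℕP.≤-trans (ℕP.+-mono-≤ (weight-positive i) (length≤∣∣C I)) (ℕP.≤-reflexive (sym (∣∣C-∷ i I)))

splits-++ : ∀ (I : List A) {p} → p ∈ splits I → proj₁ p ++ proj₂ p ≡ I
splits-++ []      (here refl) = refl
splits-++ (i ∷ I) (here refl) = refl
splits-++ (i ∷ I) (there m) with ∈-map⁻ _ m
... | p , p∈ , refl = cong (i ∷_) (splits-++ I p∈)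

part-ind : ∀ (φ : Fun ℓ) n I → part φ n I ≡ ind (‖ I ‖ ≟V n) * φ I
part-ind φ n I with ‖ I ‖ ≟V n
... | yes _ = sym (*-identityˡ (φ I))
... | no _  = sym (*-zeroˡ (φ I))

part-≡ : ∀ (φ : Fun ℓ) {n} I → ‖ I ‖ ≡ n → part φ n I ≡ φ I
part-≡ φ {n} I e with ‖ I ‖ ≟V n
... | yes _ = refl
... | no ¬e = contradiction e ¬e

part-≢ : ∀ (φ : Fun ℓ) {n} I → ‖ I ‖ ≢ n → part φ n I ≡ 0ℚ
part-≢ φ {n} I ¬e with ‖ I ‖ ≟V n
... | yes e = contradiction e ¬e
... | no _  = refl

part-cong : ∀ {φ ψ : Fun ℓ} n → (∀ I → ‖ I ‖ ≡ n → φ I ≡ ψ I) → part φ n ≈F part ψ n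
part-cong n e I with ‖ I ‖ ≟V n
... | yes eq = e I eq
... | no _   = refl

Supported : Vec ℕ ℓ → Fun ℓ → Set
Supported n φ = ∀ I → ‖ I ‖ ≢ n → φ I ≡ 0ℚ

part-supported : ∀ (φ : Fun ℓ) n → Supported n (part φ n)
part-supported φ n I = part-≢ φ I

⋆-supported : ∀ {m n} {φ ψ : Fun ℓ} → Supported m φ → Supported n ψ → Supported (m +V n) (φ ⋆ ψ)
⋆-supported {m = m} {n} {φ} {ψ} sφ sψ I I≢ = ∑-zero (splits I) λ {p} p∈ → vanish p (splits-++ I p∈)
  where
  vanish : ∀ p → proj₁ p ++ proj₂ p ≡ I → φ (proj₁ p) * ψ (proj₂ p) ≡ 0ℚ
  vanish (J , K) refl with ‖ J ‖ ≟V m | ‖ K ‖ ≟V n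
  ... | no J≢ | _     = trans (cong (_* ψ K) (sφ J J≢)) (*-zeroˡ (ψ K))
  ... | yes _ | no K≢ = trans (cong (φ J *_) (sψ K K≢)) (*-zeroʳ (φ J))
  ... | yes e | yes f = contradiction (trans (‖‖-++ J K) (cong₂ _+V_ e f)) I≢

-- Prefixes and suffixes of `I` are no heavier than `I`. This permits replacing a series by a finite
-- truncation when a product is evaluated.
⋆-local : ∀ {w} {φ φ′ ψ ψ′ : Fun ℓ} →
          (∀ I → ∣ I ∣C ≤ w → φ I ≡ φ′ I) → (∀ I → ∣ I ∣C ≤ w → ψ I ≡ ψ′ I) →
          ∀ I → ∣ I ∣C ≤ w → (φ ⋆ ψ) I ≡ (φ′ ⋆ ψ′) I
⋆-local {w = w} {φ} {φ′} {ψ} {ψ′} e e′ I I≤ = ∑-cong-∈ (splits I) λ {p} p∈ → pt p (splits-++ I p∈)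
  where
  pt : ∀ p → proj₁ p ++ proj₂ p ≡ I → φ (proj₁ p) * ψ (proj₂ p) ≡ φ′ (proj₁ p) * ψ′ (proj₂ p)
  pt (J , K) refl = cong₂ _*_ (e J (ℕP.≤-trans (ℕP.m≤m+n _ _) J+K≤)) (e′ K (ℕP.≤-trans (ℕP.m≤n+m _ _) J+K≤))
    where
    J+K≤ : ∣ J ∣C ℕ.+ ∣ K ∣C ≤ w
    J+K≤ = ℕP.≤-trans (ℕP.≤-reflexive (sym (∣∣C-++ J K))) I≤

-- Enumeration of vectors and compositions of bounded weight

-- Each entry is bounded rather than the weight; any finite list containing all vectors of weight at
-- most `w` serves.
boundedVecs : ∀ ℓ → ℕ → List (Vec ℕ ℓ)
boundedVecs zero    w = [] ∷ []
boundedVecs (suc ℓ) w = cartesianProductWith _∷_ (upTo (suc w)) (boundedVecs ℓ w)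

∈-boundedVecs : ∀ {w} (v : Vec ℕ ℓ) → weight v ≤ w → v ∈ boundedVecs ℓ w
∈-boundedVecs []      v≤ = here refl
∈-boundedVecs (a ∷ v) v≤ = ∈-cartesianProductWith⁺ _∷_
  (∈-upTo⁺ (s≤s (ℕP.m+n≤o⇒m≤o a v≤))) (∈-boundedVecs v (ℕP.m+n≤o⇒n≤o a v≤))

asNZ : Vec ℕ ℓ → List (NZ ℓ)
asNZ v with ℕ.nonZero? (weight v)
... | yes nz = (v , nz) ∷ []
... | no _   = []

∈-asNZ : ∀ (i : NZ ℓ) → i ∈ asNZ (proj₁ i)
∈-asNZ (v , nz) with ℕ.nonZero? (weight v)
... | yes nz′ = here (cong (v ,_) (nonZero-irr nz nz′))
... | no ¬nz  = contradiction nz ¬nz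

boundedComps : ℕ → ℕ → List (Comp ℓ)
boundedComps w zero    = [] ∷ []
boundedComps w (suc m) = [] ∷ cartesianProductWith _∷_ (concatMap asNZ (boundedVecs _ w)) (boundedComps w m)

∈-boundedComps : ∀ {w} m (I : Comp ℓ) → length I ≤ m → ∣ I ∣C ≤ w → I ∈ boundedComps w m
∈-boundedComps zero    []      _       _  = here refl
∈-boundedComps (suc m) []      _       _  = here refl
∈-boundedComps {w = w} (suc m) (i ∷ I) (s≤s l) I≤ = there (∈-cartesianProductWith⁺ _∷_
  (∈-concatMap⁺ asNZ (lose (∈-boundedVecs (proj₁ i) (ℕP.m+n≤o⇒m≤o _ i+I≤)) (∈-asNZ i)))
  (∈-boundedComps m I l (ℕP.m+n≤o⇒n≤o (weight (proj₁ i)) i+I≤)))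
  where
  i+I≤ : weight (proj₁ i) ℕ.+ ∣ I ∣C ≤ w
  i+I≤ = ℕP.≤-trans (ℕP.≤-reflexive (sym (∣∣C-∷ i I))) I≤

vecs : ℕ → List (Vec ℕ ℓ)
vecs w = deduplicate _≟V_ (boundedVecs _ w)

-- Every part weighs at least 1, so `w` also bounds the length. Deduplication supplies the
-- uniqueness required by `∑-ind`.
comps : ℕ → List (Comp ℓ)
comps w = deduplicate _≟C_ (boundedComps w w)

∈-vecs : ∀ {w} (v : Vec ℕ ℓ) → weight v ≤ w → v ∈ vecs w
∈-vecs v v≤ = ∈-deduplicate⁺ _≟V_ (∈-boundedVecs v v≤)

∈-comps : ∀ {w} (I : Comp ℓ) → ∣ I ∣C ≤ w → I ∈ comps w
∈-comps I I≤ = ∈-deduplicate⁺ _≟C_ (∈-boundedComps _ I (ℕP.≤-trans (length≤∣∣C I) I≤) I≤)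

∑-vecs : ∀ w n (f : Vec ℕ ℓ → ℚ) → (w < weight n → f n ≡ 0ℚ) →
         ∑ (vecs w) (λ v → ind (v ≟V n) * f v) ≡ f n
∑-vecs w n f z = ∑-ind _≟V_ n (vecs w) f (DecUnique.deduplicate-! _≟V_ _) λ n∉ →
  z (ℕP.≰⇒> (λ n≤ → n∉ (∈-vecs n n≤)))

∑-comps : ∀ w J (f : Fun ℓ) → (w < ∣ J ∣C → f J ≡ 0ℚ) → ∑ (comps w) (λ I → δ I J * f I) ≡ f J
∑-comps w J f z = trans (∑-cong (comps w) (λ I → cong (_* f I) (δ-ind I J)))
  (∑-ind _≟C_ J (comps w) f (DecUnique.deduplicate-! _≟C_ _) λ J∉ →
    z (ℕP.≰⇒> (λ J≤ → J∉ (∈-comps J J≤))))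

-- Turns a functional that vanishes above weight `w` into a finite combination of the S^J, the only
-- form in which `mulL` and `mulR` accept a multiplier.
toNSym : ℕ → Fun ℓ → NSym ℓ
toNSym w φ = List.map (λ J → φ J , J) (comps w)

coeff-toNSym : ∀ w (φ : Fun ℓ) I → (w < ∣ I ∣C → φ I ≡ 0ℚ) → coeff (toNSym w φ) I ≡ φ I
coeff-toNSym w φ I z = trans (∑-map (comps w) _ _)
  (trans (∑-cong (comps w) (λ J → ℚP.*-comm (φ J) (δ J I))) (∑-comps w I φ z))

part-zero : ∀ (φ : Fun ℓ) n I → weight n < ∣ I ∣C → part φ n I ≡ 0ℚ
part-zero φ n I n< = part-≢ φ I (λ { refl → ℕP.<-irrefl refl n< })

coeff-part : ∀ (φ : Fun ℓ) n → coeff (toNSym (weight n) (part φ n)) ≈F part φ n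
coeff-part φ n I = coeff-toNSym (weight n) (part φ n) I (part-zero φ n I)

⋆-∑∑ : ∀ (xs : List A) (ys : List B) (f : A → Fun ℓ) (g : B → Fun ℓ) →
       (∑F xs f ⋆ ∑F ys g) ≈F ∑F xs (λ x → ∑F ys (λ y → f x ⋆ g y))
⋆-∑∑ xs ys f g I = trans (⋆-∑ˡ xs f (∑F ys g) I) (∑-cong xs (λ x → ⋆-∑ʳ ys (f x) g I))

-- The Cauchy product by degree. The condition a + b = n is an indicator, so the two sums have
-- independent ranges.
part-⋆ : ∀ (φ ψ : Fun ℓ) n → part (φ ⋆ ψ) n ≈F
         ∑F (vecs (weight n)) (λ a → ∑F (vecs (weight n)) (λ b → ind ((a +V b) ≟V n) · (part φ a ⋆ part ψ b)))
part-⋆ {ℓ} φ ψ n I = begin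
  part (φ ⋆ ψ) n I
    -- In degree `n` only values at weight at most `weight n` matter, and there each series is the
    -- sum of its parts over `V`.
    ≡⟨ part-cong n (λ I′ e → trans (⋆-local (decompose φ) (decompose ψ) I′ (ℕP.≤-reflexive (cong weight e)))
                                   (⋆-∑∑ V V (part φ) (part ψ) I′)) I ⟩
  part (∑F V (λ a → ∑F V (λ b → part φ a ⋆ part ψ b))) n I
    ≡⟨ part-ind _ n I ⟩
  ind (‖ I ‖ ≟V n) * ∑ V (λ a → ∑ V (λ b → (part φ a ⋆ part ψ b) I))
    ≡⟨ sym (trans (∑-cong V (λ a → ∑-*ˡ V (ind (‖ I ‖ ≟V n)) _)) (∑-*ˡ V (ind (‖ I ‖ ≟V n)) _)) ⟩
  ∑ V (λ a → ∑ V (λ b → ind (‖ I ‖ ≟V n) * (part φ a ⋆ part ψ b) I))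
    ≡⟨ ∑-cong V (λ a → ∑-cong V (λ b → degree a b)) ⟩
  ∑ V (λ a → ∑ V (λ b → ind ((a +V b) ≟V n) * (part φ a ⋆ part ψ b) I)) ∎
  where
  open ≡-Reasoning
  V : List (Vec ℕ ℓ)
  V = vecs (weight n)
  decompose : ∀ (χ : Fun ℓ) J → ∣ J ∣C ≤ weight n → χ J ≡ ∑F V (part χ) J
  decompose χ J J≤ = sym (trans
    (∑-cong V (λ a → trans (part-ind χ a J)
      (cong (_* χ J) (ind-cong (‖ J ‖ ≟V a) (a ≟V ‖ J ‖) sym sym))))
    (∑-vecs (weight n) ‖ J ‖ (λ _ → χ J) (λ n< → contradiction n< (ℕP.≤⇒≯ J≤))))
  degree : ∀ a b → ind (‖ I ‖ ≟V n) * (part φ a ⋆ part ψ b) I ≡ ind ((a +V b) ≟V n) * (part φ a ⋆ part ψ b) I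
  -- The product of the parts is supported in degree a + b: away from it both sides vanish, on it
  -- the indicators coincide.
  degree a b with ‖ I ‖ ≟V (a +V b)
  ... | yes e = cong (λ m → ind (m ≟V n) * (part φ a ⋆ part ψ b) I) e
  ... | no ¬e = trans (trans (cong (ind (‖ I ‖ ≟V n) *_) z) (*-zeroʳ (ind (‖ I ‖ ≟V n))))
                      (sym (trans (cong (ind ((a +V b) ≟V n) *_) z) (*-zeroʳ (ind ((a +V b) ≟V n)))))
    where
    z : (part φ a ⋆ part ψ b) I ≡ 0ℚ
    z = ⋆-supported (part-supported φ a) (part-supported ψ b) I ¬e

-- The pairing between QSym and functionals

bound : QSym ℓ → ℕ
bound []            = 0
bound ((_ , I) ∷ h) = ∣ I ∣C ℕ.+ bound h

∣∣C≤bound : ∀ (h : QSym ℓ) {p} → p ∈ h → ∣ proj₂ p ∣C ≤ bound h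
∣∣C≤bound (p ∷ h) (here refl) = ℕP.m≤m+n _ _
∣∣C≤bound (p ∷ h) (there m)   = ℕP.≤-trans (∣∣C≤bound h m) (ℕP.m≤n+m _ _)

-- The pairing is computed on a list of terms; here it is seen to depend on the coefficients alone.
-- `w` is left free so that different lists can be compared over one range.
pairing-coeff : ∀ {w} (h : QSym ℓ) (φ : Fun ℓ) → bound h ≤ w → ⟨ h , φ ⟩ ≡ ∑ (comps w) (λ I → coeff h I * φ I)
pairing-coeff {w = w} h φ h≤ = begin
  ∑ h (λ p → proj₁ p * φ (proj₂ p))
    ≡⟨ ∑-cong-∈ h (λ {p} p∈ → cong (proj₁ p *_) (sym (trans
         (∑-cong (comps w) (λ I → cong (_* φ I) (δ-sym (proj₂ p) I)))
         (∑-comps w (proj₂ p) φ (λ w< → contradiction w< (ℕP.≤⇒≯ (ℕP.≤-trans (∣∣C≤bound h p∈) h≤))))))) ⟩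
  ∑ h (λ p → proj₁ p * ∑ (comps w) (λ I → δ (proj₂ p) I * φ I))
    ≡⟨ ∑-cong h (λ p → sym (∑-*ˡ (comps w) (proj₁ p) _)) ⟩
  ∑ h (λ p → ∑ (comps w) (λ I → proj₁ p * (δ (proj₂ p) I * φ I)))
    ≡⟨ ∑-swap h (comps w) _ ⟩
  ∑ (comps w) (λ I → ∑ h (λ p → proj₁ p * (δ (proj₂ p) I * φ I)))
    ≡⟨ ∑-cong (comps w) (λ I → trans (∑-cong h (λ p → sym (ℚP.*-assoc (proj₁ p) (δ (proj₂ p) I) (φ I)))) (∑-*ʳ h (φ I) _)) ⟩
  ∑ (comps w) (λ I → coeff h I * φ I) ∎
  where open ≡-Reasoning

pairing-≈Q : ∀ (h h′ : QSym ℓ) (φ : Fun ℓ) → h ≈Q h′ → ⟨ h , φ ⟩ ≡ ⟨ h′ , φ ⟩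
pairing-≈Q h h′ φ e = trans (pairing-coeff {w = bound h ℕ.+ bound h′} h φ (ℕP.m≤m+n _ _))
  (trans (∑-cong (comps (bound h ℕ.+ bound h′)) (λ I → cong (_* φ I) (e I))) (sym (pairing-coeff h′ φ (ℕP.m≤n+m (bound h′) (bound h)))))

pairing-cong : ∀ (h : QSym ℓ) {φ ψ : Fun ℓ} → φ ≈F ψ → ⟨ h , φ ⟩ ≡ ⟨ h , ψ ⟩
pairing-cong h e = ∑-cong h (λ p → cong (proj₁ p *_) (e (proj₂ p)))

pairing-δ : ∀ (h : QSym ℓ) I → ⟨ h , δ I ⟩ ≡ coeff h I
pairing-δ h I = ∑-cong h (λ p → cong (proj₁ p *_) (δ-sym I (proj₂ p)))

pairing-++ : ∀ (h h′ : QSym ℓ) φ → ⟨ h ++ h′ , φ ⟩ ≡ ⟨ h , φ ⟩ + ⟨ h′ , φ ⟩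
pairing-++ h h′ φ = ∑-++ h h′ _

pairing-• : ∀ c (h : QSym ℓ) φ → ⟨ c • h , φ ⟩ ≡ c * ⟨ h , φ ⟩
pairing-• c h φ = trans (∑-map h _ _) (trans (∑-cong h (λ p → ℚP.*-assoc c (proj₁ p) _)) (∑-*ˡ h c _))

pairing-∑F : ∀ (h : QSym ℓ) (xs : List A) (f : A → Fun ℓ) → ⟨ h , ∑F xs f ⟩ ≡ ∑ xs (λ x → ⟨ h , f x ⟩)
pairing-∑F h xs f = trans (∑-cong h (λ p → sym (∑-*ˡ xs (proj₁ p) _))) (∑-swap h xs _)

pairing-· : ∀ (h : QSym ℓ) c φ → ⟨ h , c · φ ⟩ ≡ c * ⟨ h , φ ⟩
pairing-· h c φ = trans
  (∑-cong h (λ p → solve 3 (λ a b d → a :* (b :* d) := b :* (a :* d)) refl (proj₁ p) c (φ (proj₂ p))))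
  (∑-*ˡ h c _)

pairing-zeroF : ∀ (h : QSym ℓ) → ⟨ h , zeroF ⟩ ≡ 0ℚ
pairing-zeroF h = ∑-zero h (λ {p} _ → *-zeroʳ (proj₁ p))

pairing-⊕ : ∀ (h : QSym ℓ) φ ψ → ⟨ h , φ ⊕ ψ ⟩ ≡ ⟨ h , φ ⟩ + ⟨ h , ψ ⟩
pairing-⊕ h φ ψ = trans (∑-cong h (λ p → ℚP.*-distribˡ-+ (proj₁ p) _ _)) (∑-+ h _ _)

pairing-⊖ : ∀ (h : QSym ℓ) φ ψ → ⟨ h , φ ⊖ ψ ⟩ ≡ ⟨ h , φ ⟩ - ⟨ h , ψ ⟩
pairing-⊖ h φ ψ = trans
  (∑-cong h (λ p → solve 3 (λ a b c → a :* (b :- c) := a :* b :+ (:- (a :* c))) refl (proj₁ p) (φ (proj₂ p)) (ψ (proj₂ p))))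
  (trans (∑-+ h _ _) (cong (⟨ h , φ ⟩ +_) (∑-neg h _)))

pairing-compo : ∀ n (h : QSym ℓ) φ → ⟨ compo n h , φ ⟩ ≡ ⟨ h , part φ n ⟩
pairing-compo n h φ = trans (∑-map h _ _) (∑-cong h λ p → begin
  part (λ _ → proj₁ p) n (proj₂ p) * φ (proj₂ p)     ≡⟨ cong (_* φ (proj₂ p)) (part-ind _ n (proj₂ p)) ⟩
  ind (‖ proj₂ p ‖ ≟V n) * proj₁ p * φ (proj₂ p)
    ≡⟨ solve 3 (λ a b c → a :* b :* c := b :* (a :* c)) refl (ind (‖ proj₂ p ‖ ≟V n)) (proj₁ p) (φ (proj₂ p)) ⟩
  proj₁ p * (ind (‖ proj₂ p ‖ ≟V n) * φ (proj₂ p))   ≡⟨ cong (proj₁ p *_) (sym (part-ind φ n (proj₂ p))) ⟩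
  proj₁ p * part φ n (proj₂ p)                       ∎)
  where open ≡-Reasoning

part-part : ∀ (φ : Fun ℓ) n → part (part φ n) n ≈F part φ n
part-part φ n = part-cong n (λ I e → part-≡ φ I e)

-- `compo n` is adjoint to `part`, so its idempotence is inherited from `part-part`.
compo-homogeneous : ∀ n (h : QSym ℓ) → Homogeneous n (compo n h)
compo-homogeneous n h I = begin
  coeff (compo n h) I                  ≡⟨ sym (pairing-δ (compo n h) I) ⟩
  ⟨ compo n h , δ I ⟩                  ≡⟨ pairing-compo n h (δ I) ⟩
  ⟨ h , part (δ I) n ⟩                 ≡⟨ pairing-cong h (λ J → sym (part-part (δ I) n J)) ⟩
  ⟨ h , part (part (δ I) n) n ⟩        ≡⟨ sym (pairing-compo n h (part (δ I) n)) ⟩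
  ⟨ compo n h , part (δ I) n ⟩         ≡⟨ sym (pairing-compo n (compo n h) (δ I)) ⟩
  ⟨ compo n (compo n h) , δ I ⟩        ≡⟨ pairing-δ (compo n (compo n h)) I ⟩
  coeff (compo n (compo n h)) I        ∎
  where open ≡-Reasoning

bound⊗ : List (QSym ℓ × QSym ℓ) → ℕ
bound⊗ []             = 0
bound⊗ ((s , t) ∷ ts) = bound s ℕ.+ bound t ℕ.+ bound⊗ ts

bound≤bound⊗ : ∀ (ts : List (QSym ℓ × QSym ℓ)) {t} → t ∈ ts → bound (proj₁ t) ℕ.+ bound (proj₂ t) ≤ bound⊗ ts
bound≤bound⊗ (_ ∷ ts) (here refl) = ℕP.m≤m+n _ _
bound≤bound⊗ (_ ∷ ts) (there m)   = ℕP.≤-trans (bound≤bound⊗ ts m) (ℕP.m≤n+m _ _)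

⋆-comps : ∀ {w} (φ ψ : Fun ℓ) I → ∣ I ∣C ≤ w →
          (φ ⋆ ψ) I ≡ ∑ (comps w) (λ J → ∑ (comps w) (λ K → δ (J ++ K) I * (φ J * ψ K)))
⋆-comps {ℓ} {w} φ ψ I I≤ = trans (⋆-local (expand φ) (expand ψ) I I≤) (trans (⋆-∑∑ C C _ _ I)
  (∑-cong C λ J → ∑-cong C λ K → begin
    ((φ J · δ J) ⋆ (ψ K · δ K)) I   ≡⟨ ⋆-·ˡ (φ J) (δ J) (ψ K · δ K) I ⟩
    φ J * (δ J ⋆ (ψ K · δ K)) I     ≡⟨ cong (φ J *_) (⋆-·ʳ (ψ K) (δ J) (δ K) I) ⟩
    φ J * (ψ K * (δ J ⋆ δ K) I)     ≡⟨ cong (λ z → φ J * (ψ K * z)) (δ-⋆ J K I) ⟩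
    φ J * (ψ K * δ (J ++ K) I)
      ≡⟨ solve 3 (λ a b c → a :* (b :* c) := c :* (a :* b)) refl (φ J) (ψ K) (δ (J ++ K) I) ⟩
    δ (J ++ K) I * (φ J * ψ K)      ∎))
  where
  open ≡-Reasoning
  C : List (Comp ℓ)
  C = comps w
  expand : ∀ (χ : Fun ℓ) J → ∣ J ∣C ≤ w → χ J ≡ ∑F C (λ K → χ K · δ K) J
  expand χ J J≤ = sym (trans (∑-cong C (λ K → ℚP.*-comm (χ K) (δ K J)))
    (∑-comps w J χ (λ w< → contradiction w< (ℕP.≤⇒≯ J≤))))

-- Duality of product and coproduct for an arbitrary presentation `ts` of Δh. Both sides are
-- expanded over compositions up to a weight bounding `h` and every tensor factor in `ts`.
pairing-⋆ : ∀ (h : QSym ℓ) (ts : List (QSym ℓ × QSym ℓ)) →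
            (∀ J K → coeff h (J ++ K) ≡ ∑ ts (λ t → coeff (proj₁ t) J * coeff (proj₂ t) K)) →
            ∀ φ ψ → ⟨ h , φ ⋆ ψ ⟩ ≡ ∑ ts (λ t → ⟨ proj₁ t , φ ⟩ * ⟨ proj₂ t , ψ ⟩)
pairing-⋆ {ℓ} h ts Δh φ ψ = begin
  ∑ h (λ p → proj₁ p * (φ ⋆ ψ) (proj₂ p))
    ≡⟨ ∑-cong-∈ h (λ {p} p∈ → cong (proj₁ p *_)
         (⋆-comps φ ψ (proj₂ p) (ℕP.≤-trans (∣∣C≤bound h p∈) (ℕP.m≤m+n _ _)))) ⟩
  ∑ h (λ p → proj₁ p * ∑ C (λ J → ∑ C (λ K → δ (J ++ K) (proj₂ p) * (φ J * ψ K))))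
    ≡⟨ pairing-∑F h C _ ⟩
  ∑ C (λ J → ⟨ h , ∑F C (λ K → λ I → δ (J ++ K) I * (φ J * ψ K)) ⟩)
    ≡⟨ ∑-cong C (λ J → pairing-∑F h C _) ⟩
  ∑ C (λ J → ∑ C (λ K → ⟨ h , (λ I → δ (J ++ K) I * (φ J * ψ K)) ⟩))
    ≡⟨ ∑-cong C (λ J → ∑-cong C (λ K → scalar J K)) ⟩
  ∑ C (λ J → ∑ C (λ K → ∑ ts (λ t → (coeff (proj₁ t) J * φ J) * (coeff (proj₂ t) K * ψ K))))
    ≡⟨ ∑-cong C (λ J → ∑-swap C ts _) ⟩
  ∑ C (λ J → ∑ ts (λ t → ∑ C (λ K → (coeff (proj₁ t) J * φ J) * (coeff (proj₂ t) K * ψ K))))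
    ≡⟨ ∑-swap C ts _ ⟩
  ∑ ts (λ t → ∑ C (λ J → ∑ C (λ K → (coeff (proj₁ t) J * φ J) * (coeff (proj₂ t) K * ψ K))))
    ≡⟨ ∑-cong ts (λ t → ∑-product C C _ _) ⟩
  ∑ ts (λ t → ∑ C (λ J → coeff (proj₁ t) J * φ J) * ∑ C (λ K → coeff (proj₂ t) K * ψ K))
    ≡⟨ ∑-cong-∈ ts (λ {t} t∈ → sym (cong₂ _*_
         (pairing-coeff (proj₁ t) φ (ℕP.≤-trans (ℕP.m≤m+n _ _) (t≤ t∈)))
         (pairing-coeff (proj₂ t) ψ (ℕP.≤-trans (ℕP.m≤n+m _ _) (t≤ t∈))))) ⟩
  ∑ ts (λ t → ⟨ proj₁ t , φ ⟩ * ⟨ proj₂ t , ψ ⟩) ∎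
  where
  open ≡-Reasoning
  w : ℕ
  w = bound h ℕ.+ bound⊗ ts
  C : List (Comp ℓ)
  C = comps w
  t≤ : ∀ {t} → t ∈ ts → bound (proj₁ t) ℕ.+ bound (proj₂ t) ≤ w
  t≤ t∈ = ℕP.≤-trans (bound≤bound⊗ ts t∈) (ℕP.m≤n+m _ _)
  scalar : ∀ J K → ⟨ h , (λ I → δ (J ++ K) I * (φ J * ψ K)) ⟩ ≡
                   ∑ ts (λ t → (coeff (proj₁ t) J * φ J) * (coeff (proj₂ t) K * ψ K))
  scalar J K = begin
    ⟨ h , (λ I → δ (J ++ K) I * (φ J * ψ K)) ⟩
      ≡⟨ ∑-cong h (λ p → sym (ℚP.*-assoc (proj₁ p) (δ (J ++ K) (proj₂ p)) (φ J * ψ K))) ⟩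
    ∑ h (λ p → proj₁ p * δ (J ++ K) (proj₂ p) * (φ J * ψ K))
      ≡⟨ ∑-*ʳ h (φ J * ψ K) _ ⟩
    ⟨ h , δ (J ++ K) ⟩ * (φ J * ψ K)
      ≡⟨ cong (_* (φ J * ψ K)) (trans (pairing-δ h (J ++ K)) (Δh J K)) ⟩
    ∑ ts (λ t → coeff (proj₁ t) J * coeff (proj₂ t) K) * (φ J * ψ K)
      ≡⟨ sym (∑-*ʳ ts (φ J * ψ K) _) ⟩
    ∑ ts (λ t → coeff (proj₁ t) J * coeff (proj₂ t) K * (φ J * ψ K))
      ≡⟨ ∑-cong ts (λ t → solve 4 (λ a b c d → a :* b :* (c :* d) := (a :* c) :* (b :* d)) refl
           (coeff (proj₁ t) J) (coeff (proj₂ t) K) (φ J) (ψ K)) ⟩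
    ∑ ts (λ t → (coeff (proj₁ t) J * φ J) * (coeff (proj₂ t) K * ψ K)) ∎

-- Logarithms of the two characters

-- `_/_` reduces fractions by a gcd, which is stuck on a variable; the identity is therefore checked
-- on unnormalised fractions.
ι-suc : ∀ n → (pos (suc n) / 1) ≡ 1ℚ + (pos n / 1)
ι-suc n = ℚP.toℚᵘ-injective (begin
  toℚᵘ (pos (suc n) / 1)                   ≈⟨ ℚP.toℚᵘ-fromℚᵘ (ℚᵘ.mkℚᵘ (pos (suc n)) 0) ⟩
  ℚᵘ.mkℚᵘ (pos (suc n)) 0                  ≈⟨ ℚᵘ.*≡* (cong (ℤ._* (pos 1)) (cong (λ z → pos 1 ℤ.+ z) (sym (ℤP.*-identityʳ (pos n))))) ⟩
  ℚᵘ.1ℚᵘ ℚᵘ.+ ℚᵘ.mkℚᵘ (pos n) 0           ≈⟨ ℚᵘP.+-congʳ ℚᵘ.1ℚᵘ (ℚᵘP.≃-sym (ℚP.toℚᵘ-fromℚᵘ (ℚᵘ.mkℚᵘ (pos n) 0))) ⟩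
  ℚᵘ.1ℚᵘ ℚᵘ.+ toℚᵘ (pos n / 1)            ≈⟨ ℚᵘP.≃-sym (ℚP.toℚᵘ-homo-+ 1ℚ (pos n / 1)) ⟩
  toℚᵘ (1ℚ + (pos n / 1))                ∎)
  where open ℚᵘP.≃-Reasoning

/-inverse : ∀ n → (pos 1 / suc n) * (pos (suc n) / 1) ≡ 1ℚ
/-inverse n = ℚP.toℚᵘ-injective (begin
  toℚᵘ ((pos 1 / suc n) * (pos (suc n) / 1))             ≈⟨ ℚP.toℚᵘ-homo-* (pos 1 / suc n) (pos (suc n) / 1) ⟩
  toℚᵘ (pos 1 / suc n) ℚᵘ.* toℚᵘ (pos (suc n) / 1)
    ≈⟨ ℚᵘP.*-cong (ℚP.toℚᵘ-fromℚᵘ (ℚᵘ.mkℚᵘ (pos 1) n)) (ℚP.toℚᵘ-fromℚᵘ (ℚᵘ.mkℚᵘ (pos (suc n)) 0)) ⟩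
  ℚᵘ.mkℚᵘ (pos 1) n ℚᵘ.* ℚᵘ.mkℚᵘ (pos (suc n)) 0           ≈⟨ ℚᵘ.*≡* (cong (λ z → pos (suc z)) (+0-*1 n)) ⟩
  ℚᵘ.1ℚᵘ ∎)
  where
  open ℚᵘP.≃-Reasoning
  +0-*1 : ∀ n → (n ℕ.+ 0) ℕ.* 1 ≡ n ℕ.* 1 ℕ.+ 0
  +0-*1 n = trans (ℕP.*-identityʳ _) (cong (ℕ._+ 0) (sym (ℕP.*-identityʳ n)))

sgn-+ : ∀ m n → sgn (m ℕ.+ n) ≡ sgn m * sgn n
sgn-+ zero    n = sym (*-identityˡ (sgn n))
sgn-+ (suc m) n = trans (cong -_ (sgn-+ m n)) (ℚP.neg-distribˡ-* (sgn m) (sgn n))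

sgn-even : ∀ {n} → Even n → sgn n ≡ 1ℚ
sgn-even (divides q refl) = go q
  where
  go : ∀ q → sgn (q ℕ.* 2) ≡ 1ℚ
  go zero    = refl
  go (suc q) = trans (solve 1 (λ a → :- (:- a) := a) refl (sgn (q ℕ.* 2))) (go q)

sgn-odd : ∀ {n} → Odd n → sgn n ≡ - 1ℚ
sgn-odd {zero}        o = contradiction (2 Div.∣0) o
sgn-odd {suc zero}    o = refl
sgn-odd {suc (suc n)} o = trans (solve 1 (λ a → :- (:- a) := a) refl (sgn n))
  (sgn-odd (λ 2∣n → o (Div.∣m∣n⇒∣m+n (Div.∣-refl {2}) 2∣n)))

-- The number of ordinary compositions of N with m parts.
compCount : ℕ → ℕ → ℚ
compCount zero    zero    = 1ℚ
compCount zero    (suc m) = 0ℚ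
compCount (suc N) zero    = 0ℚ
compCount (suc N) (suc m) = compCount N m + compCount N (suc m)

compCount-one : ∀ N → compCount (suc N) 1 ≡ 1ℚ
compCount-one zero    = refl
compCount-one (suc N) = trans (+-identityˡ _) (compCount-one N)

compCount-zero : ∀ {N m} → N < m → compCount N m ≡ 0ℚ
compCount-zero {zero}  {suc m} _       = refl
compCount-zero {suc N} {suc m} (s≤s N<m) =
  cong₂ _+_ (compCount-zero N<m) (compCount-zero (ℕP.m<n⇒m<1+n N<m))

-- compCount (1 + N) (1 + m) is the binomial coefficient C(N, m).
compCount-absorb : ∀ N m → (pos N / 1) * compCount N m ≡ (pos m / 1) * compCount (suc N) (suc m)
compCount-absorb zero zero    = refl
compCount-absorb zero (suc m) = trans (*-zeroˡ 0ℚ) (sym (*-zeroʳ (pos (suc m) / 1)))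
compCount-absorb (suc N) zero = trans (*-zeroʳ (pos (suc N) / 1)) (sym (*-zeroˡ (compCount (suc (suc N)) 1)))
compCount-absorb (suc N) (suc m) = begin
  (pos (suc N) / 1) * (a + b)                 ≡⟨ cong (_* (a + b)) (ι-suc N) ⟩
  (1ℚ + n) * (a + b)
    -- Splitting off one copy of `a + b` leaves `n * a` and `n * b`, the two instances given by the
    -- induction hypothesis.
    ≡⟨ solve 4 (λ u n a b → (u :+ n) :* (a :+ b) := (n :* a :+ n :* b) :+ u :* (a :+ b)) refl 1ℚ n a b ⟩
  n * a + n * b + 1ℚ * (a + b)            ≡⟨ cong (_+ 1ℚ * (a + b)) (cong₂ _+_ (compCount-absorb N m)
                                               (trans (compCount-absorb N (suc m)) (cong (_* c) (ι-suc m)))) ⟩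
  k * (a + b) + (1ℚ + k) * c + 1ℚ * (a + b)
    ≡⟨ solve 4 (λ u k s c → k :* s :+ (u :+ k) :* c :+ u :* s := (u :+ k) :* (s :+ c)) refl 1ℚ k (a + b) c ⟩
  (1ℚ + k) * (a + b + c)                  ≡⟨ cong (_* (a + b + c)) (sym (ι-suc m)) ⟩
  (pos (suc m) / 1) * (a + b + c)             ∎
  where
  open ≡-Reasoning
  n k a b c : ℚ
  n = pos N / 1
  k = pos m / 1
  a = compCount N m
  b = compCount N (suc m)
  c = compCount (suc N) (suc (suc m))

-- Powers and truncated logarithms

pow : Fun ℓ → ℕ → Fun ℓ
pow z zero    = εF
pow z (suc m) = z ⋆ pow z m

-- For `z` without constant term, `pow z m` vanishes on compositions shorter than `m`, so on length
-- at most `M` this is the full series log(1+z).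
log≤ : ℕ → Fun ℓ → Fun ℓ
log≤ zero    z = zeroF
log≤ (suc M) z = log≤ M z ⊕ (logCoeff (suc M) · pow z (suc M))

logSum : ℕ → (ℕ → ℚ) → ℚ
logSum zero    f = 0ℚ
logSum (suc M) f = logSum M f + logCoeff (suc M) * f (suc M)

log≤-logSum : ∀ M s (f : ℕ → ℚ) (z : Fun ℓ) I → (∀ m → pow z m I ≡ s * f m) → log≤ M z I ≡ s * logSum M f
log≤-logSum zero    s f z I e = sym (*-zeroʳ s)
log≤-logSum (suc M) s f z I e = trans
  (cong₂ _+_ (log≤-logSum M s f z I e) (cong (logCoeff (suc M) *_) (e (suc M))))
  (solve 4 (λ s a l b → s :* a :+ l :* (s :* b) := s :* (a :+ l :* b)) refl s (logSum M f) (logCoeff (suc M)) (f (suc M)))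

logSum-> : ∀ {N} M → M < N → logSum M (λ m → ind (N ℕ.≟ m)) ≡ 0ℚ
logSum-> zero    _ = refl
logSum-> {N} (suc M) M<N = cong₂ _+_ (logSum-> M (ℕP.<-trans (ℕP.n<1+n M) M<N))
  (trans (cong (logCoeff (suc M) *_) (ind-no (N ℕ.≟ suc M) (λ { refl → ℕP.<-irrefl refl M<N }))) (*-zeroʳ (logCoeff (suc M))))

logSum-ind : ∀ {N} M → N ≤ M → logSum M (λ m → ind (N ℕ.≟ m)) ≡ logCoeff N
logSum-ind zero z≤n = refl
logSum-ind {N} (suc M) N≤ with N ℕ.≟ suc M
... | yes refl = trans (cong₂ _+_ (logSum-> M ℕP.≤-refl) (ℚP.*-identityʳ (logCoeff (suc M)))) (+-identityˡ (logCoeff (suc M)))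
... | no N≢ = trans (cong₂ _+_ (logSum-ind M (ℕP.≤-pred (ℕP.≤∧≢⇒< N≤ N≢))) (*-zeroʳ (logCoeff (suc M)))) (+-identityʳ (logCoeff N))

-- After compCount-absorb the left side is 1/(N+1) times a truncated alternating
-- row sum of binomial coefficients, which has a closed form.
logSum-compCount-partial : ∀ N M → logSum M (compCount (suc N)) ≡
  (pos 1 / suc N) * (1ℚ - sgn M * compCount (suc N) (suc M))
logSum-compCount-partial N zero = sym (trans
  (cong (λ z → (pos 1 / suc N) * (1ℚ - 1ℚ * z)) (compCount-one N)) (*-zeroʳ (pos 1 / suc N)))
logSum-compCount-partial N (suc M) = begin
  logSum M (compCount (suc N)) + s * q * c
    ≡⟨ cong₂ _+_ (logSum-compCount-partial N M) (ℚP.*-assoc s q c) ⟩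
  r * (1ℚ - s * c) + s * (q * c)
    ≡⟨ cong (λ z → r * (1ℚ - s * c) + s * z) absorb ⟩
  r * (1ℚ - s * c) + s * (r * (c + d))
    ≡⟨ solve 5 (λ r u s c d → r :* (u :- s :* c) :+ s :* (r :* (c :+ d)) := r :* (u :- (:- s) :* d)) refl r 1ℚ s c d ⟩
  r * (1ℚ - (- s) * d) ∎
  where
  open ≡-Reasoning
  r q s c d : ℚ
  r = pos 1 / suc N
  q = pos 1 / suc M
  s = sgn M
  c = compCount (suc N) (suc M)
  d = compCount (suc N) (suc (suc M))
  -- In binomial form, C(N,M)/(M+1) = C(N+1,M+1)/(N+1), where `c + d` is C(N+1,M+1) by Pascal's
  -- rule.
  absorb : q * c ≡ r * (c + d)
  absorb = begin
    q * c                                  ≡⟨ sym (*-identityˡ (q * c)) ⟩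
    1ℚ * (q * c)                           ≡⟨ cong (_* (q * c)) (sym (/-inverse N)) ⟩
    r * (pos (suc N) / 1) * (q * c)
      ≡⟨ solve 4 (λ r n q c → r :* n :* (q :* c) := r :* q :* (n :* c)) refl r (pos (suc N) / 1) q c ⟩
    r * q * ((pos (suc N) / 1) * c)            ≡⟨ cong (r * q *_) (compCount-absorb (suc N) (suc M)) ⟩
    r * q * ((pos (suc M) / 1) * (c + d))
      ≡⟨ solve 4 (λ r q m e → r :* q :* (m :* e) := q :* m :* (r :* e)) refl r q (pos (suc M) / 1) (c + d) ⟩
    q * (pos (suc M) / 1) * (r * (c + d))      ≡⟨ cong (_* (r * (c + d))) (/-inverse M) ⟩
    1ℚ * (r * (c + d))                     ≡⟨ *-identityˡ (r * (c + d)) ⟩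
    r * (c + d)                            ∎

-- For positive `N`, the remainder in the closed form counts compositions of `N` with `M` + 1 parts,
-- more than `N`, and so vanishes. This is log ζ⁻¹ = -log ζ on coefficients.
logSum-compCount : ∀ {N} M → N ≤ M → sgn N * logSum M (compCount N) ≡ - logCoeff N
logSum-compCount {zero} M _ = trans (*-identityˡ (logSum M (compCount 0))) (vanish M)
  where
  vanish : ∀ M → logSum M (compCount 0) ≡ 0ℚ
  vanish zero    = refl
  vanish (suc M) = cong₂ _+_ (vanish M) (*-zeroʳ (logCoeff (suc M)))
logSum-compCount {suc N} M N≤ = begin
  - s * logSum M (compCount (suc N))                          ≡⟨ cong (- s *_) (logSum-compCount-partial N M) ⟩
  - s * (r * (1ℚ - sgn M * compCount (suc N) (suc M)))        ≡⟨ cong (λ z → - s * (r * (1ℚ - sgn M * z))) (compCount-zero (s≤s N≤)) ⟩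
  - s * (r * (1ℚ - sgn M * 0ℚ))                               ≡⟨ cong (λ z → - s * (r * (1ℚ - z))) (*-zeroʳ (sgn M)) ⟩
  - s * (r * 1ℚ)                                              ≡⟨ cong (- s *_) (ℚP.*-identityʳ r) ⟩
  - s * r                                                     ≡⟨ sym (ℚP.neg-distribˡ-* s r) ⟩
  - (s * r)                                                   ∎
  where
  open ≡-Reasoning
  s r : ℚ
  s = sgn N
  r = pos 1 / suc N

ζ̄⁺ : Fun ℓ
ζ̄⁺ = ζ̄Q ⊖ εF

sgn∣[]∣ : ∀ ℓ → sgn ∣ [] {A = NZ ℓ} ∣C ≡ 1ℚ
sgn∣[]∣ ℓ = cong sgn (weight-zeroV ℓ)

sgn-∣∣C-∷ : ∀ i (I : Comp ℓ) → sgn ∣ i ∷ I ∣C ≡ sgn (weight (proj₁ i)) * sgn ∣ I ∣C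
sgn-∣∣C-∷ i I = trans (cong sgn (∣∣C-∷ i I)) (sgn-+ (weight (proj₁ i)) ∣ I ∣C)

ζ̄⁺-[] : ζ̄⁺ {ℓ} [] ≡ 0ℚ
ζ̄⁺-[] {ℓ} = cong (λ z → z * 1ℚ - 1ℚ) (sgn∣[]∣ ℓ)

ζ̄⁺-∷ : ∀ i (I : Comp ℓ) → ζ̄⁺ (i ∷ I) ≡ sgn (weight (proj₁ i)) * εF I
ζ̄⁺-∷ {ℓ} i [] = begin
  sgn ∣ i ∷ [] ∣C * 1ℚ - 0ℚ                  ≡⟨ +-identityʳ _ ⟩
  sgn ∣ i ∷ [] ∣C * 1ℚ                       ≡⟨ cong (_* 1ℚ) (trans (sgn-∣∣C-∷ i []) (cong (sgn (weight (proj₁ i)) *_) (sgn∣[]∣ ℓ))) ⟩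
  sgn (weight (proj₁ i)) * 1ℚ * 1ℚ           ≡⟨ ℚP.*-identityʳ _ ⟩
  sgn (weight (proj₁ i)) * 1ℚ                ∎
  where open ≡-Reasoning
ζ̄⁺-∷ i (j ∷ I) = trans (+-identityʳ _) (trans (*-zeroʳ (sgn ∣ i ∷ j ∷ I ∣C)) (sym (*-zeroʳ (sgn (weight (proj₁ i))))))

-- `ζ̄⁺` lives on compositions of length 1, so only the cut of `I` into single parts contributes;
-- the signs multiply because weight is additive.
pow-ζ̄⁺ : ∀ m (I : Comp ℓ) → pow ζ̄⁺ m I ≡ sgn ∣ I ∣C * ind (length I ℕ.≟ m)
pow-ζ̄⁺ {ℓ} zero [] = sym (cong (_* 1ℚ) (sgn∣[]∣ ℓ))
pow-ζ̄⁺ zero (i ∷ I) = sym (*-zeroʳ (sgn ∣ i ∷ I ∣C))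
pow-ζ̄⁺ {ℓ} (suc m) [] = trans (⋆-[] (ζ̄⁺ {ℓ}) (pow ζ̄⁺ m)) (trans (cong (_* pow {ℓ} ζ̄⁺ m []) (ζ̄⁺-[] {ℓ}))
  (trans (*-zeroˡ (pow {ℓ} ζ̄⁺ m [])) (sym (*-zeroʳ (sgn ∣ [] {A = NZ ℓ} ∣C)))))
pow-ζ̄⁺ {ℓ} (suc m) (i ∷ I) = begin
  (ζ̄⁺ ⋆ pow ζ̄⁺ m) (i ∷ I)
    ≡⟨ ⋆-∷ ζ̄⁺ (pow ζ̄⁺ m) i I ⟩
  ζ̄⁺ {ℓ} [] * pow ζ̄⁺ m (i ∷ I) + ((λ J → ζ̄⁺ (i ∷ J)) ⋆ pow ζ̄⁺ m) I
    ≡⟨ cong₂ _+_ (trans (cong (_* pow ζ̄⁺ m (i ∷ I)) (ζ̄⁺-[] {ℓ})) (*-zeroˡ (pow ζ̄⁺ m (i ∷ I)))) (⋆-congˡ (pow ζ̄⁺ m) (ζ̄⁺-∷ i) I) ⟩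
  0ℚ + ((s · εF) ⋆ pow ζ̄⁺ m) I
    ≡⟨ trans (+-identityˡ _) (trans (⋆-·ˡ s εF (pow ζ̄⁺ m) I) (cong (s *_) (⋆-identityˡ (pow ζ̄⁺ m) I))) ⟩
  s * pow ζ̄⁺ m I
    ≡⟨ cong (s *_) (pow-ζ̄⁺ m I) ⟩
  s * (sgn ∣ I ∣C * ind (length I ℕ.≟ m))
    ≡⟨ sym (ℚP.*-assoc s (sgn ∣ I ∣C) _) ⟩
  s * sgn ∣ I ∣C * ind (length I ℕ.≟ m)
    ≡⟨ cong₂ _*_ (sym (sgn-∣∣C-∷ i I)) (ind-cong (length I ℕ.≟ m) (suc (length I) ℕ.≟ suc m) (cong suc) ℕP.suc-injective) ⟩
  sgn ∣ i ∷ I ∣C * ind (length (i ∷ I) ℕ.≟ suc m) ∎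
  where
  open ≡-Reasoning
  s : ℚ
  s = sgn (weight (proj₁ i))

log-ζ̄⁺ : ∀ {M} (I : Comp ℓ) → length I ≤ M → log≤ M ζ̄⁺ I ≡ sgn ∣ I ∣C * logCoeff (length I)
log-ζ̄⁺ {M = M} I I≤ = trans (log≤-logSum M (sgn ∣ I ∣C) _ ζ̄⁺ I (λ m → pow-ζ̄⁺ m I)) (cong (sgn ∣ I ∣C *_) (logSum-ind M I≤))

module _ (ζinv : Fun ℓ) (inv : (ζQ ⋆ ζinv) ≈F εF) where

  ζinv⁺ : Fun ℓ
  ζinv⁺ = ζinv ⊖ εF

  ζinv-[] : ζinv [] ≡ 1ℚ
  ζinv-[] = trans (sym (*-identityˡ (ζinv []))) (trans (sym (⋆-[] ζQ ζinv)) (inv []))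

  -- The left derivative of `ζQ` at `i` is `εF`, so ζ ζ⁻¹ = ε read at `i ∷ I` says that the two
  -- values cancel.
  ζinv-∷ : ∀ i I → ζinv (i ∷ I) ≡ - ζinv I
  ζinv-∷ i I = begin
    ζinv (i ∷ I)                               ≡⟨ solve 2 (λ a b → a := (a :+ b) :- b) refl (ζinv (i ∷ I)) (ζinv I) ⟩
    ζinv (i ∷ I) + ζinv I - ζinv I             ≡⟨ cong (_- ζinv I) (cong₂ _+_ (sym (*-identityˡ (ζinv (i ∷ I))))
                                                   (sym (trans (⋆-congˡ ζinv tail I) (⋆-identityˡ ζinv I)))) ⟩
    1ℚ * ζinv (i ∷ I) + ((λ J → ζQ (i ∷ J)) ⋆ ζinv) I - ζinv I
                                               ≡⟨ cong (_- ζinv I) (trans (sym (⋆-∷ ζQ ζinv i I)) (inv (i ∷ I))) ⟩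
    0ℚ - ζinv I                                ≡⟨ +-identityˡ _ ⟩
    - ζinv I                                   ∎
    where
    open ≡-Reasoning
    tail : (λ J → ζQ (i ∷ J)) ≈F εF
    tail []      = refl
    tail (_ ∷ _) = refl

  ζinv⁺-[] : ζinv⁺ [] ≡ 0ℚ
  ζinv⁺-[] = cong (_- 1ℚ) ζinv-[]

  ζinv⁺-∷ : ∀ i I → ζinv⁺ (i ∷ I) ≡ - 1ℚ * (ζinv⁺ I + εF I)
  ζinv⁺-∷ i I = trans (+-identityʳ _) (trans (ζinv-∷ i I)
    (trans (cong -_ (solve 2 (λ a b → a := (a :- b) :+ b) refl (ζinv I) (εF I)))
      (trans (cong -_ (sym (*-identityˡ (ζinv⁺ I + εF I)))) (ℚP.neg-distribˡ-* 1ℚ (ζinv⁺ I + εF I)))))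

  -- The power sums over cuts of `I` into `m` nonempty blocks. Either the first part is a block by
  -- itself, the `εF` term, or it joins the next block, the `ζinv⁺` term; this is the recursion of
  -- `compCount`.
  pow-ζinv⁺ : ∀ m I → pow ζinv⁺ m I ≡ sgn (length I) * compCount (length I) m
  pow-ζinv⁺ zero    []      = refl
  pow-ζinv⁺ zero    (i ∷ I) = sym (*-zeroʳ (sgn (length (i ∷ I))))
  pow-ζinv⁺ (suc m) []      = trans (⋆-[] ζinv⁺ (pow ζinv⁺ m))
    (trans (cong (_* pow ζinv⁺ m []) ζinv⁺-[]) (*-zeroˡ (pow ζinv⁺ m [])))
  pow-ζinv⁺ (suc m) (i ∷ I) = begin
    (ζinv⁺ ⋆ pow ζinv⁺ m) (i ∷ I)
      ≡⟨ ⋆-∷ ζinv⁺ (pow ζinv⁺ m) i I ⟩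
    ζinv⁺ [] * pow ζinv⁺ m (i ∷ I) + ((λ J → ζinv⁺ (i ∷ J)) ⋆ pow ζinv⁺ m) I
      ≡⟨ cong₂ _+_ (trans (cong (_* pow ζinv⁺ m (i ∷ I)) ζinv⁺-[]) (*-zeroˡ (pow ζinv⁺ m (i ∷ I))))
           (⋆-congˡ (pow ζinv⁺ m) (ζinv⁺-∷ i) I) ⟩
    0ℚ + (((- 1ℚ) · (ζinv⁺ ⊕ εF)) ⋆ pow ζinv⁺ m) I
      ≡⟨ trans (+-identityˡ _) (trans (⋆-·ˡ (- 1ℚ) (ζinv⁺ ⊕ εF) (pow ζinv⁺ m) I)
           (cong (- 1ℚ *_) (⋆-⊕ˡ ζinv⁺ εF (pow ζinv⁺ m) I))) ⟩
    - 1ℚ * (pow ζinv⁺ (suc m) I + (εF ⋆ pow ζinv⁺ m) I)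
      ≡⟨ cong (- 1ℚ *_) (cong₂ _+_ (pow-ζinv⁺ (suc m) I) (trans (⋆-identityˡ (pow ζinv⁺ m) I) (pow-ζinv⁺ m I))) ⟩
    - 1ℚ * (s * compCount (length I) (suc m) + s * compCount (length I) m)
      ≡⟨ solve 4 (λ u s a b → (:- u) :* (s :* a :+ s :* b) := u :* ((:- s) :* (b :+ a))) refl
           1ℚ s (compCount (length I) (suc m)) (compCount (length I) m) ⟩
    1ℚ * (- s * (compCount (length I) m + compCount (length I) (suc m)))
      ≡⟨ *-identityˡ _ ⟩
    - s * (compCount (length I) m + compCount (length I) (suc m)) ∎
    where
    open ≡-Reasoning
    s : ℚ
    s = sgn (length I)

  log-ζinv⁺ : ∀ {M} I → length I ≤ M → log≤ M ζinv⁺ I ≡ - logCoeff (length I)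
  log-ζinv⁺ {M} I I≤ = trans (log≤-logSum M (sgn (length I)) _ ζinv⁺ I (λ m → pow-ζinv⁺ m I)) (logSum-compCount M I≤)

  log-difference : ∀ {M} I → length I ≤ M →
                   (log≤ M ζ̄⁺ ⊖ log≤ M ζinv⁺) I ≡ (sgn ∣ I ∣C + 1ℚ) * logCoeff (length I)
  log-difference I I≤ = trans (cong₂ _-_ (log-ζ̄⁺ I I≤) (log-ζinv⁺ I I≤))
    (trans (solve 2 (λ s c → s :* c :- (:- c) := s :* c :+ c) refl (sgn ∣ I ∣C) (logCoeff (length I)))
      (trans (cong (λ z → sgn ∣ I ∣C * logCoeff (length I) + z) (sym (*-identityˡ (logCoeff (length I)))))
        (sym (ℚP.*-distribʳ-+ (logCoeff (length I)) (sgn ∣ I ∣C) 1ℚ))))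

-- Ideals

module _ {G : Fun ℓ → Set} where

  -- A scalar acts as the multiplier c S^().
  InIdeal-· : ∀ c {f} → InIdeal G f → InIdeal G (c · f)
  InIdeal-· c {f} p = resp scale (mulL ((c , []) ∷ []) p)
    where
    scale : (coeff ((c , []) ∷ []) ⋆ f) ≈F (c · f)
    scale I = trans (⋆-congˡ {φ = coeff ((c , []) ∷ [])} f (λ J → trans (+-identityʳ _) (cong (c *_) (δ-ε J))) I)
      (trans (⋆-·ˡ c εF f I) (cong (c *_) (⋆-identityˡ f I)))

  InIdeal-∑F : ∀ (xs : List A) {f : A → Fun ℓ} → (∀ x → InIdeal G (f x)) → InIdeal G (∑F xs f)
  InIdeal-∑F []       p = zer
  InIdeal-∑F (x ∷ xs) p = add (p x) (InIdeal-∑F xs p)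

  InIdeal-⊖ : ∀ {f g} → InIdeal G f → InIdeal G g → InIdeal G (f ⊖ g)
  InIdeal-⊖ {f} {g} p q = resp
    (λ I → cong (λ z → f I + z) (trans (sym (ℚP.neg-distribˡ-* 1ℚ (g I))) (cong -_ (*-identityˡ (g I)))))
    (add p (InIdeal-· (- 1ℚ) q))

InIdeal-mono : ∀ {G H : Fun ℓ → Set} → (∀ {g} → G g → InIdeal H g) → ∀ {f} → InIdeal G f → InIdeal H f
InIdeal-mono sub (gen g)    = sub g
InIdeal-mono sub zer        = zer
InIdeal-mono sub (add p q)  = add (InIdeal-mono sub p) (InIdeal-mono sub q)
InIdeal-mono sub (mulL a p) = mulL a (InIdeal-mono sub p)
InIdeal-mono sub (mulR a p) = mulR a (InIdeal-mono sub p)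
InIdeal-mono sub (resp e p) = resp e (InIdeal-mono sub p)

-- The order bound and homogeneous parts

≤ᵢ-+ : ∀ m n k → (m ℕ.+ n) ≤ᵢ k → m ≤ᵢ k × n ≤ᵢ k
≤ᵢ-+ m n (fin k) p = ℕP.m+n≤o⇒m≤o m p , ℕP.m+n≤o⇒n≤o m p
≤ᵢ-+ m n ∞       p = tt , tt

≤k-+V : ∀ (a b : Vec ℕ ℓ) k → (a +V b) ≤k k → a ≤k k × b ≤k k
≤k-+V []      []      []      p = tt , tt
≤k-+V (m ∷ a) (n ∷ b) (k ∷ ks) (p , ps) with ≤ᵢ-+ m n k p | ≤k-+V a b ks ps
... | m≤ , n≤ | a≤ , b≤ = (m≤ , a≤) , (n≤ , b≤)

_≤ᵢ?_ : ∀ m k → Dec (m ≤ᵢ k)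
m ≤ᵢ? fin k = m ℕ.≤? k
m ≤ᵢ? ∞     = yes tt

_≤k?_ : ∀ (n : Vec ℕ ℓ) k → Dec (n ≤k k)
[]      ≤k? []       = yes tt
(m ∷ n) ≤k? (k ∷ ks) = (m ≤ᵢ? k) ×-dec (n ≤k? ks)

part-⊕ : ∀ (f g : Fun ℓ) n → part (f ⊕ g) n ≈F (part f n ⊕ part g n)
part-⊕ f g n I with ‖ I ‖ ≟V n
... | yes _ = refl
... | no _  = refl

part-⊖ : ∀ (f g : Fun ℓ) n → part (f ⊖ g) n ≈F (part f n ⊖ part g n)
part-⊖ f g n I with ‖ I ‖ ≟V n
... | yes _ = refl
... | no _  = refl

part-· : ∀ c (f : Fun ℓ) n → part (c · f) n ≈F (c · part f n)
part-· c f n I with ‖ I ‖ ≟V n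
... | yes _ = refl
... | no _  = sym (*-zeroʳ c)

part-zeroF : ∀ n → part {ℓ} zeroF n ≈F zeroF
part-zeroF n I with ‖ I ‖ ≟V n
... | yes _ = refl
... | no _  = refl

part-weight-0 : ∀ (φ : Fun ℓ) {a} → φ [] ≡ 0ℚ → weight a ≡ 0 → part φ a ≈F zeroF
part-weight-0 φ {a} φ0 a0 [] with ‖ [] ‖ ≟V a
... | yes _ = φ0
... | no _  = refl
part-weight-0 φ {a} φ0 a0 (i ∷ I) = part-zero φ a (i ∷ I)
  (ℕP.<-≤-trans (ℕP.≤-reflexive (cong suc a0)) (ℕP.≤-trans (s≤s z≤n) (length≤∣∣C (i ∷ I))))

pow-difference : ∀ (x y : Fun ℓ) m →
  (pow x (suc m) ⊖ pow y (suc m)) ≈F ((x ⋆ (pow x m ⊖ pow y m)) ⊕ ((x ⊖ y) ⋆ pow y m))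
pow-difference x y m I = sym (trans (cong₂ _+_ (⋆-⊖ʳ x (pow x m) (pow y m) I) (⋆-⊖ˡ x y (pow y m) I))
  (solve 3 (λ a b c → (a :- b) :+ (b :- c) := a :- c) refl
    ((x ⋆ pow x m) I) ((x ⋆ pow y m) I) ((y ⋆ pow y m) I)))

-- Series whose parts of small weight lie in an ideal

module _ (G : Fun ℓ → Set) (k : Vec ℕ∞ ℓ) where

  InIdeal< : ℕ → Fun ℓ → Set
  InIdeal< w f = ∀ n → n ≤k k → weight n < w → InIdeal G (part f n)

  InIdeal<-resp : ∀ {w f g} → f ≈F g → InIdeal< w f → InIdeal< w g
  InIdeal<-resp e p n n≤ n< = resp (part-cong n (λ I _ → e I)) (p n n≤ n<)

  InIdeal<-⊕ : ∀ {w f g} → InIdeal< w f → InIdeal< w g → InIdeal< w (f ⊕ g)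
  InIdeal<-⊕ {f = f} {g} p q n n≤ n< = resp (λ I → sym (part-⊕ f g n I)) (add (p n n≤ n<) (q n n≤ n<))

  InIdeal<-· : ∀ {w} c {f} → InIdeal< w f → InIdeal< w (c · f)
  InIdeal<-· c {f} p n n≤ n< = resp (λ I → sym (part-· c f n I)) (InIdeal-· c (p n n≤ n<))

  InIdeal<-pred : ∀ {w f} → InIdeal< (suc w) f → InIdeal< w f
  InIdeal<-pred p n n≤ n< = p n n≤ (ℕP.m<n⇒m<1+n n<)

  private
    assemble : ∀ φ ψ n → (∀ a b → a +V b ≡ n → InIdeal G (part φ a ⋆ part ψ b)) → InIdeal G (part (φ ⋆ ψ) n)
    assemble φ ψ n p = resp (λ I → sym (part-⋆ φ ψ n I)) (InIdeal-∑F (vecs (weight n)) λ a →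
      InIdeal-∑F (vecs (weight n)) λ b → term a b ((a +V b) ≟V n))
      where
      term : ∀ a b (d : Dec (a +V b ≡ n)) → InIdeal G (ind d · (part φ a ⋆ part ψ b))
      term a b (yes e) = InIdeal-· 1ℚ (p a b e)
      term a b (no _)  = resp (λ I → sym (*-zeroˡ ((part φ a ⋆ part ψ b) I))) zer

  -- A factor without constant term raises the degree.
  InIdeal<-⋆ˡ : ∀ {w f} φ → φ [] ≡ 0ℚ → InIdeal< w f → InIdeal< (suc w) (φ ⋆ f)
  InIdeal<-⋆ˡ {w} {f} φ φ0 p n n≤ n< = assemble φ f n λ a b e → summand a b e (weight a ℕ.≟ 0)
    where
    summand : ∀ a b → a +V b ≡ n → Dec (weight a ≡ 0) → InIdeal G (part φ a ⋆ part f b)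
    summand a b e (yes a0) = resp (λ I → sym (trans (⋆-congˡ (part f b) (part-weight-0 φ φ0 a0) I) (⋆-zeroˡ (part f b) I))) zer
    summand a b refl (no a≢0) = resp (⋆-congˡ (part f b) (coeff-part φ a))
      (mulL (toNSym (weight a) (part φ a)) (p b (proj₂ (≤k-+V a b k n≤)) b<))
      where
      b< : weight b < w
      b< = ℕP.<-≤-trans (ℕP.+-monoˡ-≤ (weight b) (ℕP.n≢0⇒n>0 a≢0))
        (ℕP.≤-trans (ℕP.≤-reflexive (sym (weight-+V a b))) (ℕP.≤-pred n<))

  InIdeal<-⋆ʳ : ∀ {w f} φ → φ [] ≡ 0ℚ → InIdeal< w f → InIdeal< (suc w) (f ⋆ φ)
  InIdeal<-⋆ʳ {w} {f} φ φ0 p n n≤ n< = assemble f φ n λ a b e → summand a b e (weight b ℕ.≟ 0)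
    where
    summand : ∀ a b → a +V b ≡ n → Dec (weight b ≡ 0) → InIdeal G (part f a ⋆ part φ b)
    summand a b e (yes b0) = resp (λ I → sym (trans (⋆-congʳ (part f a) (part-weight-0 φ φ0 b0) I) (⋆-zeroʳ (part f a) I))) zer
    summand a b refl (no b≢0) = resp (⋆-congʳ (part f a) (coeff-part φ b))
      (mulR (toNSym (weight b) (part φ b)) (p a (proj₁ (≤k-+V a b k n≤)) a<))
      where
      a< : weight a < w
      a< = ℕP.<-≤-trans (ℕP.≤-<-trans (ℕP.≤-reflexive (sym (ℕP.+-identityʳ (weight a)))) (ℕP.+-monoʳ-< (weight a) (ℕP.n≢0⇒n>0 b≢0)))
        (ℕP.≤-trans (ℕP.≤-reflexive (sym (weight-+V a b))) (ℕP.≤-pred n<))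

  module _ (x y : Fun ℓ) (x0 : x [] ≡ 0ℚ) (y0 : y [] ≡ 0ℚ) {w} (x-y : InIdeal< w (x ⊖ y)) where

    -- From exponent 2 on, each summand of `pow-difference` pairs a difference known below `w` with
    -- a factor without constant term, which gains one unit of weight. Exponent 1 is `x ⊖ y` itself
    -- and gains nothing, hence the weaker companion.
    pow-InIdeal< : ∀ m → InIdeal< (suc w) (pow x (2 ℕ.+ m) ⊖ pow y (2 ℕ.+ m))
    pow-InIdeal<′ : ∀ m → InIdeal< w (pow x (1 ℕ.+ m) ⊖ pow y (1 ℕ.+ m))

    pow-InIdeal< m = InIdeal<-resp (λ I → sym (pow-difference x y (suc m) I))
      (InIdeal<-⊕ (InIdeal<-⋆ˡ x x0 (pow-InIdeal<′ m)) (InIdeal<-⋆ʳ (pow y (suc m)) y^0 x-y))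
      where
      y^0 : pow y (suc m) [] ≡ 0ℚ
      y^0 = trans (⋆-[] y (pow y m)) (trans (cong (_* pow y m []) y0) (*-zeroˡ (pow y m [])))
    pow-InIdeal<′ zero    = InIdeal<-resp (λ I → sym (cong₂ _-_ (⋆-identityʳ x I) (⋆-identityʳ y I))) x-y
    pow-InIdeal<′ (suc m) = InIdeal<-pred (pow-InIdeal< m)

    -- As `logCoeff 1` is 1, subtracting `x ⊖ y` cancels the linear terms, and the remaining
    -- exponents are at least 2.
    log-InIdeal< : ∀ M → InIdeal< (suc w) ((log≤ (suc M) x ⊖ log≤ (suc M) y) ⊖ (x ⊖ y))
    log-InIdeal< zero n n≤ n< = resp (λ I → sym (trans (part-cong n (λ J _ → vanish J) I) (part-zeroF n I))) zer
      where
      vanish : ((log≤ 1 x ⊖ log≤ 1 y) ⊖ (x ⊖ y)) ≈F zeroF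
      vanish I = begin
        (0ℚ + 1ℚ * (x ⋆ εF) I - (0ℚ + 1ℚ * (y ⋆ εF) I)) - (x I - y I)
          ≡⟨ cong₂ (λ a b → a - b - (x I - y I)) (unit x) (unit y) ⟩
        x I - y I - (x I - y I)
          ≡⟨ ℚP.+-inverseʳ (x I - y I) ⟩
        0ℚ ∎
        where
        open ≡-Reasoning
        unit : ∀ z → 0ℚ + 1ℚ * (z ⋆ εF) I ≡ z I
        unit z = trans (+-identityˡ _) (trans (*-identityˡ _) (⋆-identityʳ z I))
    log-InIdeal< (suc M) = InIdeal<-resp regroup
      (InIdeal<-⊕ (log-InIdeal< M) (InIdeal<-· (logCoeff (2 ℕ.+ M)) (pow-InIdeal< M)))
      where
      regroup : (((log≤ (suc M) x ⊖ log≤ (suc M) y) ⊖ (x ⊖ y)) ⊕ (logCoeff (2 ℕ.+ M) · (pow x (2 ℕ.+ M) ⊖ pow y (2 ℕ.+ M))))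
                ≈F ((log≤ (2 ℕ.+ M) x ⊖ log≤ (2 ℕ.+ M) y) ⊖ (x ⊖ y))
      regroup I = solve 6 (λ a b c l p q → (a :- b :- c) :+ l :* (p :- q) := (a :+ l :* p) :- (b :+ l :* q) :- c) refl
        (log≤ (suc M) x I) (log≤ (suc M) y I) (x I - y I) (logCoeff (2 ℕ.+ M)) (pow x (2 ℕ.+ M) I) (pow y (2 ℕ.+ M) I)

-- Comparison of the two families of generators

module _ (k : Vec ℕ∞ ℓ) (ζinv : Fun ℓ) (inv : (ζQ ⋆ ζinv) ≈F εF) where

  private
    x y : Fun ℓ
    x = ζ̄⁺
    y = ζinv⁺ ζinv inv

    -- Compositions of degree `n` have length at most `weight n`, so the truncation is exact there;
    -- the successor fits the form of `log-InIdeal<`.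
    logDiff : Vec ℕ ℓ → Fun ℓ
    logDiff n = log≤ (suc (weight n)) x ⊖ log≤ (suc (weight n)) y

    x-y : (ζ̄Q ⊖ ζinv) ≈F (x ⊖ y)
    x-y I = solve 3 (λ a b c → a :- b := (a :- c) :- (b :- c)) refl (ζ̄Q I) (ζinv I) (εF I)

    part-logDiff : ∀ n → part (logDiff n) n ≈F part (λ I → (sgn (weight n) + 1ℚ) * logCoeff (length I)) n
    part-logDiff n = part-cong n λ { I refl →
      log-difference ζinv inv I (ℕP.m≤n⇒m≤1+n (length≤∣∣C I)) }

    -- The step shared by both inclusions. The hypothesis on smaller weights holds by definition for
    -- the ideal of `GenIO`, and by induction for that of `GenΦ`.
    reduce : ∀ {G} n → n ≤k k → InIdeal< G k (weight n) (ζ̄Q ⊖ ζinv) →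
             InIdeal G (part (logDiff n) n ⊖ part (ζ̄Q ⊖ ζinv) n)
    reduce {G} n n≤ low = resp
      (λ I → trans (part-⊖ (logDiff n) (x ⊖ y) n I) (cong (λ z → part (logDiff n) n I - z) (part-cong n (λ J _ → sym (x-y J)) I)))
      (log-InIdeal< G k x y (ζ̄⁺-[] {ℓ}) (ζinv⁺-[] ζinv inv) (InIdeal<-resp G k x-y low) (weight n) n n≤ (ℕP.n<1+n (weight n)))

  GenΦ⊆GenIO : ∀ {g} → GenΦ k g → InIdeal (GenIO k ζinv) g
  GenΦ⊆GenIO ((n , _) , n≤ , even , refl) = resp rescale
    -- For even weight the degree-`n` part of the difference of logarithms is 2 Φ_n / |n|, whence
    -- the factor |n|/2.
    (InIdeal-· (ℚ.½ * (pos (weight n) / 1)) (resp recombine (add (reduce n n≤ (λ m m≤ _ → generator m m≤)) (generator n n≤))))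
    where
    generator : ∀ m → m ≤k k → InIdeal (GenIO k ζinv) (part (ζ̄Q ⊖ ζinv) m)
    generator m m≤ = resp (λ I → sym (part-⊖ ζ̄Q ζinv m I)) (gen (m , m≤ , refl))
    recombine : ((part (logDiff n) n ⊖ part (ζ̄Q ⊖ ζinv) n) ⊕ part (ζ̄Q ⊖ ζinv) n) ≈F part (logDiff n) n
    recombine I = solve 2 (λ a b → a :- b :+ b := a) refl (part (logDiff n) n I) (part (ζ̄Q ⊖ ζinv) n I)
    rescale : ((ℚ.½ * (pos (weight n) / 1)) · part (logDiff n) n) ≈F Φ n
    rescale I = trans (cong (ℚ.½ * (pos (weight n) / 1) *_) (part-logDiff n I))
      (trans (sym (part-· (ℚ.½ * (pos (weight n) / 1)) _ n I)) (part-cong n (λ J _ → begin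
        ℚ.½ * ι * ((sgn (weight n) + 1ℚ) * logCoeff (length J)) ≡⟨ cong (λ s → ℚ.½ * ι * ((s + 1ℚ) * logCoeff (length J))) (sgn-even even) ⟩
        ℚ.½ * ι * ((1ℚ + 1ℚ) * logCoeff (length J))
          ≡⟨ solve 4 (λ h i t l → h :* i :* (t :* l) := h :* t :* (i :* l)) refl ℚ.½ ι (1ℚ + 1ℚ) (logCoeff (length J)) ⟩
        1ℚ * (ι * logCoeff (length J))                          ≡⟨ *-identityˡ _ ⟩
        ι * logCoeff (length J)                                 ∎) I))
      where
      open ≡-Reasoning
      ι : ℚ
      ι = pos (weight n) / 1

  private
    logDiff-in-GenΦ : ∀ n → n ≤k k → InIdeal (GenΦ k) (part (logDiff n) n)
    logDiff-in-GenΦ n n≤ = resp (λ I → sym (part-logDiff n I)) (cases (2 Div.∣? weight n) (weight n) refl)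
      where
      L : Fun ℓ
      L = part (λ I → (sgn (weight n) + 1ℚ) * logCoeff (length I)) n
      cases : Dec (Even (weight n)) → ∀ w → weight n ≡ w → InIdeal (GenΦ k) L
      cases (no odd) w e = resp (λ I → sym (trans (part-cong n (λ J _ →
          trans (cong (λ s → (s + 1ℚ) * logCoeff (length J)) (sgn-odd odd)) (*-zeroˡ (logCoeff (length J)))) I)
          (part-zeroF n I))) zer
      -- Weight 0 is even, but no generator of `GenΦ` has degree 0; the part vanishes because
      -- `logCoeff 0` is 0.
      cases (yes _) zero e = resp (λ I → sym (part-weight-0 _ (*-zeroʳ (sgn (weight n) + 1ℚ)) e I)) zer
      cases (yes even) (suc w) e = resp (λ I → trans (sym (part-· c _ n I)) (part-cong n (λ J _ → scalar J) I))
        (InIdeal-· c (gen ((n , subst NonZero (sym e) _) , n≤ , even , refl)))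
        where
        open ≡-Reasoning
        c : ℚ
        c = (sgn (weight n) + 1ℚ) * (pos 1 / suc w)
        scalar : ∀ J → c * ((pos (weight n) / 1) * logCoeff (length J)) ≡ (sgn (weight n) + 1ℚ) * logCoeff (length J)
        scalar J = begin
          c * ((pos (weight n) / 1) * logCoeff (length J))
            ≡⟨ cong (λ v → c * ((pos v / 1) * logCoeff (length J))) e ⟩
          c * ((pos (suc w) / 1) * logCoeff (length J))
            ≡⟨ solve 4 (λ s r i l → s :* r :* (i :* l) := s :* (r :* i :* l)) refl (sgn (weight n) + 1ℚ) (pos 1 / suc w) (pos (suc w) / 1) (logCoeff (length J)) ⟩
          (sgn (weight n) + 1ℚ) * ((pos 1 / suc w) * (pos (suc w) / 1) * logCoeff (length J))
            ≡⟨ cong (λ u → (sgn (weight n) + 1ℚ) * (u * logCoeff (length J))) (/-inverse w) ⟩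
          (sgn (weight n) + 1ℚ) * (1ℚ * logCoeff (length J))
            ≡⟨ cong ((sgn (weight n) + 1ℚ) *_) (*-identityˡ (logCoeff (length J))) ⟩
          (sgn (weight n) + 1ℚ) * logCoeff (length J) ∎

    -- Induction on the weight bound: `logDiff-in-GenΦ` places the logarithmic part in the ideal,
    -- and `reduce` its difference from the wanted part.
    difference-in-GenΦ : ∀ w → InIdeal< (GenΦ k) k w (ζ̄Q ⊖ ζinv)
    difference-in-GenΦ (suc w) n n≤ (s≤s n≤w) = resp
      (λ I → solve 2 (λ a b → a :- (a :- b) := b) refl (part (logDiff n) n I) (part (ζ̄Q ⊖ ζinv) n I))
      (InIdeal-⊖ (logDiff-in-GenΦ n n≤)
        (reduce n n≤ (λ m m≤ m< → difference-in-GenΦ w m m≤ (ℕP.<-≤-trans m< n≤w))))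

  GenIO⊆GenΦ : ∀ {g} → GenIO k ζinv g → InIdeal (GenΦ k) g
  GenIO⊆GenΦ (n , n≤ , refl) = resp (part-⊖ ζ̄Q ζinv n) (difference-in-GenΦ (suc (weight n)) n n≤ (ℕP.n<1+n (weight n)))

-- The basis (Φ^I) and its dual

Φ^-++ : ∀ (I J : Comp ℓ) → Φ^ (I ++ J) ≈F (Φ^ I ⋆ Φ^ J)
Φ^-++ []      J K = sym (⋆-identityˡ (Φ^ J) K)
Φ^-++ (i ∷ I) J K = trans (⋆-congʳ (Φ (proj₁ i)) (Φ^-++ I J) K) (sym (⋆-assoc (Φ (proj₁ i)) (Φ^ I) (Φ^ J) K))

Φ^-supported : ∀ (I : Comp ℓ) → Supported ‖ I ‖ (Φ^ I)
Φ^-supported []      []      []≢ = contradiction refl []≢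
Φ^-supported []      (_ ∷ _) _   = refl
Φ^-supported (i ∷ I) = ⋆-supported (part-supported _ (proj₁ i)) (Φ^-supported I)

Φ^-finite : ∀ (I : Comp ℓ) → coeff (toNSym ∣ I ∣C (Φ^ I)) ≈F Φ^ I
Φ^-finite I J = coeff-toNSym ∣ I ∣C (Φ^ I) J λ I< → Φ^-supported I J (λ e → ℕP.<-irrefl (sym (cong weight e)) I<)

pairing-Φ^-zero : ∀ (h : QSym ℓ) K → bound h < ∣ K ∣C → ⟨ h , Φ^ K ⟩ ≡ 0ℚ
pairing-Φ^-zero h K h< = ∑-zero h λ {p} p∈ → trans
  (cong (proj₁ p *_) (Φ^-supported K (proj₂ p) (λ e →
    ℕP.<-irrefl (cong weight e) (ℕP.≤-<-trans (∣∣C≤bound h p∈) h<))))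
  (*-zeroʳ (proj₁ p))

-- Given inductively so that an identity linear in the functional can be proved by recursion down to
-- the `Φ^ I`, without handling coefficients.
data SpanΦ {ℓ} : Fun ℓ → Set where
  basis : ∀ I → SpanΦ (Φ^ I)
  zero  : SpanΦ zeroF
  add   : ∀ {f g} → SpanΦ f → SpanΦ g → SpanΦ (f ⊕ g)
  scale : ∀ c {f} → SpanΦ f → SpanΦ (c · f)
  resp  : ∀ {f g} → f ≈F g → SpanΦ f → SpanΦ g

SpanΦ-⋆ : ∀ {f g : Fun ℓ} → SpanΦ f → SpanΦ g → SpanΦ (f ⋆ g)
SpanΦ-⋆ (basis I)      (basis J)      = resp (Φ^-++ I J) (basis (I ++ J))
SpanΦ-⋆ (basis I)      zero           = resp (λ K → sym (⋆-zeroʳ (Φ^ I) K)) zero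
SpanΦ-⋆ (basis I)      (add {f} {g} p q) = resp (λ K → sym (⋆-⊕ʳ (Φ^ I) f g K)) (add (SpanΦ-⋆ (basis I) p) (SpanΦ-⋆ (basis I) q))
SpanΦ-⋆ (basis I)      (scale c {f} p) = resp (λ K → sym (⋆-·ʳ c (Φ^ I) f K)) (scale c (SpanΦ-⋆ (basis I) p))
SpanΦ-⋆ (basis I)      (resp e p)     = resp (⋆-congʳ (Φ^ I) e) (SpanΦ-⋆ (basis I) p)
SpanΦ-⋆ {g = g} zero           q = resp (λ K → sym (⋆-zeroˡ g K)) zero
SpanΦ-⋆ {g = g} (add {f} {f′} p p′) q = resp (λ K → sym (⋆-⊕ˡ f f′ g K)) (add (SpanΦ-⋆ p q) (SpanΦ-⋆ p′ q))
SpanΦ-⋆ {g = g} (scale c {f} p) q = resp (λ K → sym (⋆-·ˡ c f g K)) (scale c (SpanΦ-⋆ p q))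
SpanΦ-⋆ {g = g} (resp e p)     q = resp (⋆-congˡ g e) (SpanΦ-⋆ p q)

SpanΦ-∑F : ∀ (xs : List A) {f : A → Fun ℓ} → (∀ x → SpanΦ (f x)) → SpanΦ (∑F xs f)
SpanΦ-∑F []       p = zero
SpanΦ-∑F (x ∷ xs) p = add (p x) (SpanΦ-∑F xs p)

ι-invertible : ∀ w → NonZero w → ∃ λ c → c * (pos w / 1) ≡ 1ℚ
ι-invertible (suc w) _ = pos 1 / suc w , /-inverse w

-- `logCoeff` without its length-1 term, which accounts for S_n.
tailCoeff : ℕ → ℚ
tailCoeff (suc (suc m)) = logCoeff (suc (suc m))
tailCoeff _             = 0ℚ

-- Φ_n / |n| = S_n + products of lower degree.
δ-singleton : ∀ (i : NZ ℓ) c → c * (pos (weight (proj₁ i)) / 1) ≡ 1ℚ →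
  δ (i ∷ []) ≈F ((c · Φ (proj₁ i)) ⊕ ((- 1ℚ) · part (λ I → tailCoeff (length I)) (proj₁ i)))
δ-singleton {ℓ} i@(n , nz) c c-inv I with ‖ I ‖ ≟V n
... | no I≢ = trans (δ-ind (i ∷ []) I) (trans (ind-no ((i ∷ []) ≟C I) (λ { refl → I≢ (+V-identityʳ n) }))
                (sym (cong (_+ (- 1ℚ) * 0ℚ) (*-zeroʳ c))))
... | yes e = degree-n I e
  where
  cancel : ∀ l → c * ((pos (weight n) / 1) * l) ≡ l
  cancel l = trans (sym (ℚP.*-assoc c _ l)) (trans (cong (_* l) c-inv) (*-identityˡ l))
  degree-n : ∀ I → ‖ I ‖ ≡ n → δ (i ∷ []) I ≡ c * ((pos (weight n) / 1) * logCoeff (length I)) + (- 1ℚ) * tailCoeff (length I)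
  degree-n [] refl = contradiction (weight-zeroV ℓ) (ℕ.≢-nonZero⁻¹ (weight n) ⦃ nz ⦄)
  degree-n ((m , nz′) ∷ []) e with trans (sym (+V-identityʳ m)) e
  ... | refl with nonZero-irr nz nz′
  ... | refl = trans (δ-ind (i ∷ []) (i ∷ [])) (trans (ind-yes ((i ∷ []) ≟C (i ∷ [])) refl)
                 (sym (cong (_+ (- 1ℚ) * 0ℚ) (cancel (logCoeff 1)))))
  degree-n J@(j ∷ j′ ∷ J′) e = trans (δ-ind (i ∷ []) J) (trans (ind-no ((i ∷ []) ≟C J) (λ ())) (sym (begin
    c * ((pos (weight n) / 1) * l) + (- 1ℚ) * l   ≡⟨ cong₂ _+_ (cancel l) (sym (ℚP.neg-distribˡ-* 1ℚ l)) ⟩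
    l - 1ℚ * l                                ≡⟨ cong (λ z → l - z) (*-identityˡ l) ⟩
    l - l                                     ≡⟨ ℚP.+-inverseʳ l ⟩
    0ℚ                                        ∎)))
    where
    open ≡-Reasoning
    l : ℚ
    l = logCoeff (length J)

-- Up to a multiple of Φ_n, S_n is a combination of S^J of the same degree with at least two parts.
-- Those are no lighter than S_n, so they go to `long`, which factors them into strictly lighter
-- pieces before the recursion resumes.
δ-SpanΦ : ∀ (I : Comp ℓ) → SpanΦ (δ I)
δ-SpanΦ {ℓ} I = go (suc ∣ I ∣C) I (ℕP.n<1+n ∣ I ∣C)
  where
  go : ∀ w (I : Comp ℓ) → ∣ I ∣C < w → SpanΦ (δ I)
  long : ∀ w i j (I : Comp ℓ) → ∣ i ∷ j ∷ I ∣C ≤ w → SpanΦ (δ (i ∷ j ∷ I))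

  long w i j I I≤ = resp (δ-⋆ (i ∷ []) (j ∷ I)) (SpanΦ-⋆
    (go w (i ∷ []) (ℕP.<-≤-trans (ℕP.≤-<-trans (ℕP.≤-reflexive (trans (cong weight (+V-identityʳ (proj₁ i))) (sym (ℕP.+-identityʳ _))))
                      (ℕP.+-monoʳ-< (weight (proj₁ i)) (ℕP.≤-trans (s≤s z≤n) (length≤∣∣C (j ∷ I))))) sum≤))
    (go w (j ∷ I) (ℕP.<-≤-trans (ℕP.+-monoˡ-≤ ∣ j ∷ I ∣C (weight-positive i)) sum≤)))
    where
    sum≤ : weight (proj₁ i) ℕ.+ ∣ j ∷ I ∣C ≤ w
    sum≤ = ℕP.≤-trans (ℕP.≤-reflexive (sym (∣∣C-∷ i (j ∷ I)))) I≤

  go (suc w) []          _        = resp (λ K → sym (δ-ε K)) (basis [])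
  go (suc w) (i ∷ j ∷ I) (s≤s I≤) = long w i j I I≤
  go (suc w) (i ∷ [])    (s≤s I≤) = resp (λ K → sym (δ-singleton i c c-inv K))
    (add (scale c (resp (⋆-identityʳ (Φ n)) (basis (i ∷ []))))
         (scale (- 1ℚ) (resp expand (SpanΦ-∑F (comps (weight n)) summand))))
    where
    n : Vec ℕ ℓ
    n = proj₁ i
    c : ℚ
    c = proj₁ (ι-invertible (weight n) (proj₂ i))
    c-inv : c * (pos (weight n) / 1) ≡ 1ℚ
    c-inv = proj₂ (ι-invertible (weight n) (proj₂ i))
    T : Fun ℓ
    T = part (λ I → tailCoeff (length I)) n
    expand : ∑F (comps (weight n)) (λ J → T J · δ J) ≈F T
    expand K = trans (sym (∑-map (comps (weight n)) _ _)) (coeff-part (λ I → tailCoeff (length I)) n K)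
    summand : ∀ J → SpanΦ (T J · δ J)
    summand J with ‖ J ‖ ≟V n
    ... | no J≢ = resp (λ K → sym (*-zeroˡ (δ J K))) zero
    summand []            | yes e = resp (λ K → sym (*-zeroˡ (δ [] K))) zero
    summand (j ∷ [])      | yes e = resp (λ K → sym (*-zeroˡ (δ (j ∷ []) K))) zero
    summand (j ∷ j′ ∷ J)  | yes e = scale (logCoeff (length (j ∷ j′ ∷ J))) (long w j j′ J
      (ℕP.≤-trans (ℕP.≤-reflexive (cong weight (trans e (sym (+V-identityʳ n))))) I≤))

-- Coefficients are pairings with the `δ I`, and these lie in the span of the `Φ^ K`.
pairing-determined : ∀ (h h′ : QSym ℓ) → (∀ K → ⟨ h , Φ^ K ⟩ ≡ ⟨ h′ , Φ^ K ⟩) → h ≈Q h′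
pairing-determined {ℓ} h h′ e I = trans (sym (pairing-δ h I)) (trans (agree (δ-SpanΦ I)) (pairing-δ h′ I))
  where
  agree : ∀ {f : Fun ℓ} → SpanΦ f → ⟨ h , f ⟩ ≡ ⟨ h′ , f ⟩
  agree (basis K)       = e K
  agree zero            = trans (pairing-zeroF h) (sym (pairing-zeroF h′))
  agree (add {f} {g} p q) = trans (pairing-⊕ h f g) (trans (cong₂ _+_ (agree p) (agree q)) (sym (pairing-⊕ h′ f g)))
  agree (scale c {f} p) = trans (pairing-· h c f) (trans (cong (c *_) (agree p)) (sym (pairing-· h′ c f)))
  agree (resp e p)      = trans (sym (pairing-cong h e)) (trans (agree p) (pairing-cong h′ e))

p-q≡0⇒p≡q : ∀ {p q} → p - q ≡ 0ℚ → p ≡ q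
p-q≡0⇒p≡q {p} {q} e = trans (solve 2 (λ p q → p := p :- q :+ q) refl p q) (trans (cong (_+ q) e) (+-identityˡ q))

-- The odd span

-- Induction on ideal membership, for all `h` in `C` at once. Against a product, `h` pairs through
-- Δh; each tensor has both factors in `C`, and the one facing `x` gives 0.
subcoalgebra-annihilates : ∀ {G : Fun ℓ → Set} (C : QSym ℓ → Set) → (∀ {h} → C h → ΔIn⊗ C h) →
  (∀ {g h} → G g → C h → ⟨ h , g ⟩ ≡ 0ℚ) → ∀ {f} → InIdeal G f → ∀ h → C h → ⟨ h , f ⟩ ≡ 0ℚ
subcoalgebra-annihilates {ℓ} {G} C ΔC C⊥G = go
  where
  go : ∀ {f} → InIdeal G f → ∀ h → C h → ⟨ h , f ⟩ ≡ 0ℚ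
  go (gen g) h Ch = C⊥G g Ch
  go zer h Ch = pairing-zeroF h
  go (add {x} {y} p q) h Ch = trans (pairing-⊕ h x y) (cong₂ _+_ (go p h Ch) (go q h Ch))
  go (mulL {x} a p) h Ch with ΔC Ch
  ... | ts , Cts , Δh = trans (pairing-⋆ h ts Δh (coeff a) x) (∑-zero ts λ {t} t∈ →
    trans (cong (⟨ proj₁ t , coeff a ⟩ *_) (go p (proj₂ t) (proj₂ (All.lookup Cts t∈)))) (*-zeroʳ ⟨ proj₁ t , coeff a ⟩))
  go (mulR {x} a p) h Ch with ΔC Ch
  ... | ts , Cts , Δh = trans (pairing-⋆ h ts Δh x (coeff a)) (∑-zero ts λ {t} t∈ →
    trans (cong (_* ⟨ proj₂ t , coeff a ⟩) (go p (proj₁ t) (proj₁ (All.lookup Cts t∈)))) (*-zeroˡ ⟨ proj₂ t , coeff a ⟩))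
  go (resp e p) h Ch = trans (sym (pairing-cong h e)) (go p h Ch)

module _ (k : Vec ℕ∞ ℓ) where

  EvenPart : NZ ℓ → Set
  EvenPart i = proj₁ i ≤k k × Even (weight (proj₁ i))

  EvenPart? : Decidable EvenPart
  EvenPart? i = (proj₁ i ≤k? k) ×-dec (2 Div.∣? weight (proj₁ i))

  OddComp? : Decidable (OddComp k)
  OddComp? = All.all? λ i → (proj₁ i ≤k? k) →-dec ¬? (2 Div.∣? weight (proj₁ i))

  -- Decidability locates the first part that is below `k` and even; the parts before and after it
  -- become left and right multipliers.
  Φ^-in-GenΦ : ∀ J → ¬ OddComp k J → InIdeal (GenΦ k) (Φ^ J)
  Φ^-in-GenΦ []      ¬odd = contradiction [] ¬odd
  Φ^-in-GenΦ (j ∷ J) ¬odd with EvenPart? j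
  ... | yes (j≤ , even) = resp (⋆-congʳ (Φ (proj₁ j)) (Φ^-finite J))
    (mulR (toNSym ∣ J ∣C (Φ^ J)) (gen (j , j≤ , even , refl)))
  ... | no ¬even = resp (⋆-congˡ (Φ^ J) (coeff-part _ (proj₁ j)))
    (mulL (toNSym (weight (proj₁ j)) (Φ (proj₁ j))) (Φ^-in-GenΦ J λ odd → ¬odd ((λ j≤ even → ¬even (j≤ , even)) ∷ odd)))

  -- A second description of the odd span. Closure under sums, scalars and degree projection is easy
  -- here, while the coproduct is easy on the spanning elements.
  Annihilator : QSym ℓ → Set
  Annihilator h = ∀ J → ¬ OddComp k J → ⟨ h , Φ^ J ⟩ ≡ 0ℚ

  Annihilator-compo : ∀ {h} → Annihilator h → ∀ n → Annihilator (compo n h)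
  Annihilator-compo {h} ann n J ¬odd with ‖ J ‖ ≟V n
  ... | yes refl = trans (pairing-compo n h (Φ^ J)) (trans (pairing-cong h unchanged) (ann J ¬odd))
    where
    unchanged : part (Φ^ J) n ≈F Φ^ J
    unchanged I with ‖ I ‖ ≟V n
    ... | yes _ = refl
    ... | no I≢ = sym (Φ^-supported J I I≢)
  ... | no J≢ = trans (pairing-compo n h (Φ^ J)) (trans (pairing-cong h vanish) (pairing-zeroF h))
    where
    vanish : part (Φ^ J) n ≈F zeroF
    vanish I with ‖ I ‖ ≟V n
    ... | yes refl = Φ^-supported J I (λ e → J≢ (sym e))
    ... | no _     = refl

  module _ (P : Comp ℓ → QSym ℓ) (dual : IsDualToΦ P) where

    pairing-combination : ∀ (cs : List (ℚ × Comp ℓ)) φ →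
      ⟨ concatMap (λ p → proj₁ p • P (proj₂ p)) cs , φ ⟩ ≡ ∑ cs (λ p → proj₁ p * ⟨ P (proj₂ p) , φ ⟩)
    pairing-combination cs φ = trans (∑-concatMap cs _ _) (∑-cong cs (λ p → pairing-• (proj₁ p) (P (proj₂ p)) φ))

    span⇒annihilator : ∀ {h} → SpanOddP k P h → Annihilator h
    span⇒annihilator {h} (cs , odd , h≈) J ¬odd = trans (pairing-≈Q h (concatMap (λ p → proj₁ p • P (proj₂ p)) cs) (Φ^ J) h≈) (trans (pairing-combination cs (Φ^ J))
      (∑-zero cs λ {p} p∈ → trans (cong (proj₁ p *_) (trans (dual (proj₂ p) J) (trans (δ-ind (proj₂ p) J)
        (ind-no (proj₂ p ≟C J) (λ { refl → ¬odd (All.lookup odd p∈) }))))) (*-zeroʳ (proj₁ p))))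

    -- The dual basis expansion h = Σ ⟨h, Φ^J⟩ P_J: terms heavier than `bound h` vanish by degree,
    -- and those with `J` not odd by hypothesis.
    annihilator⇒span : ∀ {h} → Annihilator h → SpanOddP k P h
    annihilator⇒span {h} ann = List.map (λ J → ⟨ h , Φ^ J ⟩ , J) Odds , AllP.map⁺ (AllP.all-filter OddComp? C) ,
      pairing-determined h (concatMap (λ p → proj₁ p • P (proj₂ p)) (List.map (λ J → ⟨ h , Φ^ J ⟩ , J) Odds)) λ K → sym (begin
        ⟨ concatMap (λ p → proj₁ p • P (proj₂ p)) (List.map (λ J → ⟨ h , Φ^ J ⟩ , J) Odds) , Φ^ K ⟩
          ≡⟨ pairing-combination (List.map (λ J → ⟨ h , Φ^ J ⟩ , J) Odds) (Φ^ K) ⟩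
        ∑ (List.map (λ J → ⟨ h , Φ^ J ⟩ , J) Odds) (λ p → proj₁ p * ⟨ P (proj₂ p) , Φ^ K ⟩)
          ≡⟨ ∑-map Odds _ _ ⟩
        ∑ Odds (λ J → ⟨ h , Φ^ J ⟩ * ⟨ P J , Φ^ K ⟩)
          ≡⟨ ∑-filter OddComp? C _ (λ J ¬odd → trans (cong (_* ⟨ P J , Φ^ K ⟩) (ann J ¬odd)) (*-zeroˡ ⟨ P J , Φ^ K ⟩)) ⟩
        ∑ C (λ J → ⟨ h , Φ^ J ⟩ * ⟨ P J , Φ^ K ⟩)
          ≡⟨ ∑-cong C (λ J → trans (cong (⟨ h , Φ^ J ⟩ *_) (dual J K)) (ℚP.*-comm ⟨ h , Φ^ J ⟩ (δ J K))) ⟩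
        ∑ C (λ J → δ J K * ⟨ h , Φ^ J ⟩)
          ≡⟨ ∑-comps (bound h) K (λ J → ⟨ h , Φ^ J ⟩) (pairing-Φ^-zero h K) ⟩
        ⟨ h , Φ^ K ⟩ ∎)
      where
      open ≡-Reasoning
      C Odds : List (Comp ℓ)
      C    = comps (bound h)
      Odds = filter OddComp? C

    -- For `f` in `SpanΦ`, the coefficients of `f` on the basis (Φ^I).
    coordinates : Fun ℓ → Fun ℓ
    coordinates f I = ⟨ P I , f ⟩

    -- The Φ^I multiply by concatenation just as the S^I do, so the product has the same formula in
    -- either basis. The other cases extend this bilinearly.
    coordinates-⋆ : ∀ {f g} → SpanΦ f → SpanΦ g → coordinates (f ⋆ g) ≈F (coordinates f ⋆ coordinates g)
    coordinates-⋆ (basis A) (basis B) I = begin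
      ⟨ P I , Φ^ A ⋆ Φ^ B ⟩                        ≡⟨ pairing-cong (P I) (λ J → sym (Φ^-++ A B J)) ⟩
      ⟨ P I , Φ^ (A ++ B) ⟩                        ≡⟨ trans (dual I (A ++ B)) (δ-sym I (A ++ B)) ⟩
      δ (A ++ B) I                                 ≡⟨ sym (δ-⋆ A B I) ⟩
      (δ A ⋆ δ B) I                                ≡⟨ ⋆-cong (coord A) (coord B) I ⟩
      (coordinates (Φ^ A) ⋆ coordinates (Φ^ B)) I  ∎
      where
      open ≡-Reasoning
      coord : ∀ J → δ J ≈F coordinates (Φ^ J)
      coord J K = trans (δ-sym J K) (sym (dual K J))
    coordinates-⋆ (basis A) zero I = trans (pairing-cong (P I) (⋆-zeroʳ (Φ^ A))) (trans (pairing-zeroF (P I))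
      (sym (trans (⋆-congʳ (coordinates (Φ^ A)) (λ J → pairing-zeroF (P J)) I) (⋆-zeroʳ (coordinates (Φ^ A)) I))))
    coordinates-⋆ (basis A) (add {f} {g} p q) I = begin
      ⟨ P I , Φ^ A ⋆ (f ⊕ g) ⟩                     ≡⟨ pairing-cong (P I) (⋆-⊕ʳ (Φ^ A) f g) ⟩
      ⟨ P I , (Φ^ A ⋆ f) ⊕ (Φ^ A ⋆ g) ⟩            ≡⟨ pairing-⊕ (P I) (Φ^ A ⋆ f) (Φ^ A ⋆ g) ⟩
      ⟨ P I , Φ^ A ⋆ f ⟩ + ⟨ P I , Φ^ A ⋆ g ⟩      ≡⟨ cong₂ _+_ (coordinates-⋆ (basis A) p I) (coordinates-⋆ (basis A) q I) ⟩
      (a ⋆ coordinates f) I + (a ⋆ coordinates g) I ≡⟨ sym (⋆-⊕ʳ a (coordinates f) (coordinates g) I) ⟩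
      (a ⋆ (coordinates f ⊕ coordinates g)) I      ≡⟨ ⋆-congʳ a (λ J → sym (pairing-⊕ (P J) f g)) I ⟩
      (a ⋆ coordinates (f ⊕ g)) I                  ∎
      where
      open ≡-Reasoning
      a : Fun ℓ
      a = coordinates (Φ^ A)
    coordinates-⋆ (basis A) (scale c {f} p) I = begin
      ⟨ P I , Φ^ A ⋆ (c · f) ⟩                     ≡⟨ pairing-cong (P I) (⋆-·ʳ c (Φ^ A) f) ⟩
      ⟨ P I , c · (Φ^ A ⋆ f) ⟩                     ≡⟨ pairing-· (P I) c (Φ^ A ⋆ f) ⟩
      c * ⟨ P I , Φ^ A ⋆ f ⟩                       ≡⟨ cong (c *_) (coordinates-⋆ (basis A) p I) ⟩
      c * (a ⋆ coordinates f) I                    ≡⟨ sym (⋆-·ʳ c a (coordinates f) I) ⟩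
      (a ⋆ (c · coordinates f)) I                  ≡⟨ ⋆-congʳ a (λ J → sym (pairing-· (P J) c f)) I ⟩
      (a ⋆ coordinates (c · f)) I                  ∎
      where
      open ≡-Reasoning
      a : Fun ℓ
      a = coordinates (Φ^ A)
    coordinates-⋆ (basis A) (resp e p) I = trans (sym (pairing-cong (P I) (⋆-congʳ (Φ^ A) e)))
      (trans (coordinates-⋆ (basis A) p I) (⋆-congʳ (coordinates (Φ^ A)) (λ J → pairing-cong (P J) e) I))
    coordinates-⋆ {g = g} zero q I = trans (pairing-cong (P I) (⋆-zeroˡ g)) (trans (pairing-zeroF (P I))
      (sym (trans (⋆-congˡ (coordinates g) (λ J → pairing-zeroF (P J)) I) (⋆-zeroˡ (coordinates g) I))))
    coordinates-⋆ {g = g} (add {f} {f′} p p′) q I = begin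
      ⟨ P I , (f ⊕ f′) ⋆ g ⟩                       ≡⟨ pairing-cong (P I) (⋆-⊕ˡ f f′ g) ⟩
      ⟨ P I , (f ⋆ g) ⊕ (f′ ⋆ g) ⟩                 ≡⟨ pairing-⊕ (P I) (f ⋆ g) (f′ ⋆ g) ⟩
      ⟨ P I , f ⋆ g ⟩ + ⟨ P I , f′ ⋆ g ⟩           ≡⟨ cong₂ _+_ (coordinates-⋆ p q I) (coordinates-⋆ p′ q I) ⟩
      (coordinates f ⋆ b) I + (coordinates f′ ⋆ b) I ≡⟨ sym (⋆-⊕ˡ (coordinates f) (coordinates f′) b I) ⟩
      ((coordinates f ⊕ coordinates f′) ⋆ b) I     ≡⟨ ⋆-congˡ b (λ J → sym (pairing-⊕ (P J) f f′)) I ⟩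
      (coordinates (f ⊕ f′) ⋆ b) I                 ∎
      where
      open ≡-Reasoning
      b : Fun ℓ
      b = coordinates g
    coordinates-⋆ {g = g} (scale c {f} p) q I = begin
      ⟨ P I , (c · f) ⋆ g ⟩                        ≡⟨ pairing-cong (P I) (⋆-·ˡ c f g) ⟩
      ⟨ P I , c · (f ⋆ g) ⟩                        ≡⟨ pairing-· (P I) c (f ⋆ g) ⟩
      c * ⟨ P I , f ⋆ g ⟩                          ≡⟨ cong (c *_) (coordinates-⋆ p q I) ⟩
      c * (coordinates f ⋆ b) I                    ≡⟨ sym (⋆-·ˡ c (coordinates f) b I) ⟩
      ((c · coordinates f) ⋆ b) I                  ≡⟨ ⋆-congˡ b (λ J → sym (pairing-· (P J) c f)) I ⟩
      (coordinates (c · f) ⋆ b) I                  ∎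
      where
      open ≡-Reasoning
      b : Fun ℓ
      b = coordinates g
    coordinates-⋆ {g = g} (resp e p) q I = trans (sym (pairing-cong (P I) (⋆-congˡ g e)))
      (trans (coordinates-⋆ p q I) (⋆-congˡ (coordinates g) (λ J → pairing-cong (P J) e) I))

    -- Deconcatenation of P_I, tested against S^J and S^K; `δ-SpanΦ` brings these within reach of
    -- `coordinates-⋆`.
    P-coproduct : ∀ I J K → coeff (P I) (J ++ K) ≡
                  ∑ (splits I) (λ s → coeff (P (proj₁ s)) J * coeff (P (proj₂ s)) K)
    P-coproduct I J K = begin
      coeff (P I) (J ++ K)                          ≡⟨ sym (pairing-δ (P I) (J ++ K)) ⟩
      ⟨ P I , δ (J ++ K) ⟩                          ≡⟨ pairing-cong (P I) (λ L → sym (δ-⋆ J K L)) ⟩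
      ⟨ P I , δ J ⋆ δ K ⟩                           ≡⟨ coordinates-⋆ (δ-SpanΦ J) (δ-SpanΦ K) I ⟩
      (coordinates (δ J) ⋆ coordinates (δ K)) I     ≡⟨ ⋆-cong (λ L → pairing-δ (P L) J) (λ L → pairing-δ (P L) K) I ⟩
      ∑ (splits I) (λ s → coeff (P (proj₁ s)) J * coeff (P (proj₂ s)) K) ∎
      where open ≡-Reasoning

    P-in-span : ∀ I → OddComp k I → ∀ c → SpanOddP k P (c • P I)
    P-in-span I odd c = (c , I) ∷ [] , odd ∷ [] , λ J → sym
      (trans (∑-++ (c • P I) [] _) (+-identityʳ _))

    span-Δ : ∀ {h} → SpanOddP k P h → ΔIn⊗ (SpanOddP k P) h
    span-Δ {h} (cs , odd , h≈) = concatMap terms cs ,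
      AllP.concat⁺ (AllP.map⁺ (All.map (λ {p} o → terms-in-span p o) odd)) , λ J K → begin
        coeff h (J ++ K)
          ≡⟨ trans (h≈ (J ++ K)) (∑-concatMap cs _ _) ⟩
        ∑ cs (λ p → coeff (proj₁ p • P (proj₂ p)) (J ++ K))
          ≡⟨ ∑-cong cs (λ p → trans (coeff-• (proj₁ p) (P (proj₂ p)) (J ++ K)) (cong (proj₁ p *_) (P-coproduct (proj₂ p) J K))) ⟩
        ∑ cs (λ p → proj₁ p * ∑ (splits (proj₂ p)) (λ s → coeff (P (proj₁ s)) J * coeff (P (proj₂ s)) K))
          ≡⟨ ∑-cong cs (λ p → sym (terms-sum p J K)) ⟩
        ∑ cs (λ p → ∑ (terms p) (λ t → coeff (proj₁ t) J * coeff (proj₂ t) K))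
          ≡⟨ sym (∑-concatMap cs terms _) ⟩
        ∑ (concatMap terms cs) (λ t → coeff (proj₁ t) J * coeff (proj₂ t) K) ∎
      where
      open ≡-Reasoning
      terms : ℚ × Comp ℓ → List (QSym ℓ × QSym ℓ)
      -- The scalar goes to the left factor; `1ℚ •` gives the right one the form treated by
      -- `P-in-span`.
      terms (c , I) = List.map (λ s → (c • P (proj₁ s)) , (1ℚ • P (proj₂ s))) (splits I)
      coeff-• : ∀ c h I → coeff (c • h) I ≡ c * coeff h I
      coeff-• c h I = trans (∑-map h _ _) (trans (∑-cong h (λ p → ℚP.*-assoc c (proj₁ p) (δ (proj₂ p) I))) (∑-*ˡ h c _))
      terms-in-span : ∀ p → OddComp k (proj₂ p) → All (λ t → SpanOddP k P (proj₁ t) × SpanOddP k P (proj₂ t)) (terms p)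
      terms-in-span (c , I) odd = AllP.map⁺ (All.tabulate λ {s} s∈ → split s (splits-++ I s∈))
        where
        split : ∀ s → proj₁ s ++ proj₂ s ≡ I → SpanOddP k P (c • P (proj₁ s)) × SpanOddP k P (1ℚ • P (proj₂ s))
        split (A , B) refl = P-in-span A (AllP.++⁻ˡ A odd) c , P-in-span B (AllP.++⁻ʳ A odd) 1ℚ
      terms-sum : ∀ p J K → ∑ (terms p) (λ t → coeff (proj₁ t) J * coeff (proj₂ t) K) ≡
                  proj₁ p * ∑ (splits (proj₂ p)) (λ s → coeff (P (proj₁ s)) J * coeff (P (proj₂ s)) K)
      terms-sum (c , I) J K = trans (∑-map (splits I) _ _) (trans (∑-cong (splits I) λ s →
        trans (cong₂ _*_ (coeff-• c (P (proj₁ s)) J) (trans (coeff-• 1ℚ (P (proj₂ s)) K) (*-identityˡ (coeff (P (proj₂ s)) K))))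
          (ℚP.*-assoc c (coeff (P (proj₁ s)) J) (coeff (P (proj₂ s)) K)))
        (∑-*ˡ (splits I) c _))

    span-subspace : IsSubspace (SpanOddP k P)
    span-subspace =
      (λ {h} h≈ (cs , odd , e) → cs , odd , λ I → trans (sym (h≈ I)) (e I)) ,
      ([] , [] , λ _ → refl) ,
      (λ {h} {h′} s s′ → annihilator⇒span {h ++ h′} λ J ¬odd → trans (pairing-++ h h′ (Φ^ J))
        (cong₂ _+_ (span⇒annihilator {h} s J ¬odd) (span⇒annihilator {h′} s′ J ¬odd))) ,
      (λ c {h} s → annihilator⇒span {c • h} λ J ¬odd → trans (pairing-• c h (Φ^ J))
        (trans (cong (c *_) (span⇒annihilator {h} s J ¬odd)) (*-zeroʳ c)))

    span-subcoalgebra : IsGradedSubcoalgebra (SpanOddP k P)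
    span-subcoalgebra = span-subspace ,
      (λ {h} s n → annihilator⇒span {compo n h} (Annihilator-compo {h} (span⇒annihilator {h} s) n)) ,
      (λ {h} → span-Δ {h})

    span-annihilates-GenΦ : ∀ {g h} → GenΦ k g → SpanOddP k P h → ⟨ h , g ⟩ ≡ 0ℚ
    span-annihilates-GenΦ {h = h} (i , i≤ , even , refl) s = trans
      (pairing-cong h (λ I → sym (⋆-identityʳ (Φ (proj₁ i)) I)))
      (span⇒annihilator {h} s (i ∷ []) (λ { (odd ∷ []) → odd i≤ even }))

    module _ (ζinv : Fun ℓ) (inv : (ζQ ⋆ ζinv) ≈F εF) where

      -- A homogeneous `h` of degree `n` sees only the `n`-part of ζ̄ - ζ⁻¹, a generator already
      -- known to lie in the ideal of `GenΦ`.
      span-odd : OddCondition k ζinv (SpanOddP k P)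
      span-odd n h n≤ hom s = p-q≡0⇒p≡q (begin
        ⟨ h , ζ̄Q ⟩ - ⟨ h , ζinv ⟩              ≡⟨ sym (pairing-⊖ h ζ̄Q ζinv) ⟩
        ⟨ h , ζ̄Q ⊖ ζinv ⟩                      ≡⟨ pairing-≈Q h (compo n h) (ζ̄Q ⊖ ζinv) hom ⟩
        ⟨ compo n h , ζ̄Q ⊖ ζinv ⟩              ≡⟨ pairing-compo n h (ζ̄Q ⊖ ζinv) ⟩
        ⟨ h , part (ζ̄Q ⊖ ζinv) n ⟩             ≡⟨ pairing-cong h (part-⊖ ζ̄Q ζinv n) ⟩
        ⟨ h , part ζ̄Q n ⊖ part ζinv n ⟩        ≡⟨ subcoalgebra-annihilates (SpanOddP k P) (λ {h} → span-Δ {h})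
                                                    (λ {_} {h} → span-annihilates-GenΦ {h = h})
                                                    (GenIO⊆GenΦ k ζinv inv (n , n≤ , refl)) h s ⟩
        0ℚ                                     ∎)
        where open ≡-Reasoning

      span-largest : ∀ (D : QSym ℓ → Set) → IsGradedSubcoalgebra D → OddCondition k ζinv D →
                     ∀ h → D h → SpanOddP k P h
      span-largest D (_ , graded , ΔD) oddD h Dh = annihilator⇒span {h} λ J ¬odd →
        subcoalgebra-annihilates D ΔD vanish (InIdeal-mono (GenΦ⊆GenIO k ζinv inv) (Φ^-in-GenΦ J ¬odd)) h Dh
        where
        open ≡-Reasoning
        -- The odd condition concerns homogeneous elements only; as `D` is graded, it applies to
        -- `compo n h`, which pairs with the series as `h` does with their `n`-parts.
        vanish : ∀ {g h} → GenIO k ζinv g → D h → ⟨ h , g ⟩ ≡ 0ℚ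
        vanish {h = h} (n , n≤ , refl) Dh = begin
          ⟨ h , part ζ̄Q n ⊖ part ζinv n ⟩              ≡⟨ pairing-⊖ h (part ζ̄Q n) (part ζinv n) ⟩
          ⟨ h , part ζ̄Q n ⟩ - ⟨ h , part ζinv n ⟩
            ≡⟨ sym (cong₂ _-_ (pairing-compo n h ζ̄Q) (pairing-compo n h ζinv)) ⟩
          ⟨ compo n h , ζ̄Q ⟩ - ⟨ compo n h , ζinv ⟩
            ≡⟨ cong (_- ⟨ compo n h , ζinv ⟩) (oddD n (compo n h) n≤ (compo-homogeneous n h) (graded Dh n)) ⟩
          ⟨ compo n h , ζinv ⟩ - ⟨ compo n h , ζinv ⟩  ≡⟨ ℚP.+-inverseʳ ⟨ compo n h , ζinv ⟩ ⟩
          0ℚ                                           ∎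

theorem5p1 : ∀ {ℓ : ℕ} → 1 ≤ ℓ → (k : Vec ℕ∞ ℓ)
    → (ζinv : Fun ℓ) → IsConvInverse ζQ ζinv
    → (P : Comp ℓ → QSym ℓ) → IsDualToΦ P
    → (∀ (x : NSym ℓ) → InIdeal (GenIO k ζinv) (coeff x) ⇔ InIdeal (GenΦ k) (coeff x))
    × IsLargestOdd k ζinv (SpanOddP k P)
theorem5p1 _ k ζinv (inv , _) P dual =
  (λ x → mk⇔ (InIdeal-mono (GenIO⊆GenΦ k ζinv inv)) (InIdeal-mono (GenΦ⊆GenIO k ζinv inv))) ,
  (span-subcoalgebra k P dual , span-odd k P dual ζinv inv) ,
  span-largest k P dual ζinv inv
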